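{- Let $S$ denote the stack-sort operator and call a permutation $\pi$ West-$3$-stack-sortable if $S(S(S(\pi)))$ is the identity permutation. A permutation $\pi$ is West-$3$-stack-sortable if and only if $\pi$ avoids each of the following ten patterns (notation explained in the context): 1. $(23451;\ \text{shaded } \emptyset)$; 2. $(24351;\ \text{shaded } \{(2,4),(2,5)\})$; 3. $(32451;\ \text{shaded } \{(1,3),(1,4),(1,5)\})$; 4. $(42351;\ \text{shaded } \{(1,4),(1,5),(2,4),(2,5)\})$; 5. $(43251;\ \text{shaded } \{(1,4),(1,5),(2,3),(2,4),(2,5)\})$; 6. $(34251;\ \text{shaded } \{(1,3),(1,4),(1,5),(2,4),(2,5)\})$; 7. $(362451;\ \text{shaded } \{(0,4),(0,5),(1,3),(1,4),(1,5),(1,6),(2,4),(2,6)\};\ \text{decreasing region } \{(2,5)\})$; 8. $(364251;\ \text{shaded } \{(0,4),(0,5),(1,3),(1,4),(1,5),(1,6),(2,4),(2,6),(3,4),(3,5),(3,6)\};\ \text{decreasing region } \{(2,5)\})$; 9. $(7362451;\ \text{shaded } \{(1,4),(1,5),(1,6),(1,7),(2,3),(2,4),(2,5),(2,6),(2,7),(3,4),(3,6),(3,7)\};\ \text{decreasing region } \{(3,5)\})$; 10. $(7364251;\ \text{shaded } \{(1,4),(1,5),(1,6),(1,7),(2,3),(2,4),(2,5),(2,6),(2,7),(3,4),(3,6),(3,7),(4,4),(4,5),(4,6),(4,7)\};\ \text{decreasing region } \{(3,5)\})$.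
   Context: Permutations of $\{1,\dots,n\}$ are written in one-line notation $\pi=\pi(1)\cdots\pi(n)$. The stack-sort operator $S$ is defined by $S(\varepsilon)=\varepsilon$ and, if $\pi=\alpha\, m\,\beta$ with $m$ the largest entry, $S(\pi)=S(\alpha)S(\beta)m$ (equivalently: read $\pi$ left to right, before pushing an entry onto a stack pop to the output all stack entries smaller than it, and pop everything at the end). A classical pattern is a permutation $p$ of $\{1,\dots,k\}$. An occurrence of $p$ in $\pi\in S_n$ is a sequence of indices $i_1<\dots<i_k$ with $\pi(i_a)<\pi(i_b)\iff p(a)<p(b)$. For such an occurrence put $i_0=0$, $i_{k+1}=n+1$, and let $v_0=0$, $v_1<\dots<v_k$ be the values $\pi(i_1),\dots,\pi(i_k)$ in increasing order, $v_{k+1}=n+1$. For $(a,b)\in\{0,\dots,k\}^2$ the box $(a,b)$ corresponds to the set of entries $\pi(t)$ with $i_a<t<i_{a+1}$ and $v_b<\pi(t)<v_{b+1}$ (the first coordinate indexes horizontal positions, the second values, with $(0,0)$ the bottom-left box). The notation $(p;\ \text{shaded } R;\ \text{decreasing region } D)$ with $R,D\subseteq\{0,\dots,k\}^2$ denotes a (decorated) pattern: an occurrence of it in $\pi$ is an occurrence of $p$ such that every box in $R$ corresponds to the empty set, and the entries of $\pi$ lying in the union of the boxes of $D$ form a decreasing sequence from left to right (i.e. avoid the pattern $12$). $\pi$ avoids a pattern if it has no occurrence of it. -}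

module Defs where

open import Data.Nat using (ℕ; zero; suc; _<_; _≤_; _>_; _<?_)
open import Data.Nat.Properties using (≤-decTotalOrder)
open import Data.List using (List; []; _∷_; _++_; [_]; map; length; upTo; span)
open import Data.List.Membership.Propositional using (_∈_)
open import Data.List.Relation.Unary.All using (All)
open import Data.List.Relation.Unary.AllPairs using (AllPairs)
open import Data.List.Sort.InsertionSort.Base ≤-decTotalOrder using (sort)
open import Data.Product using (Σ; _×_; _,_)
open import Data.Empty using (⊥)
open import Relation.Nullary using (¬_)
open import Function.Bundles using (_⇔_)
open import Relation.Binary.PropositionalEquality using (_≡_)

-- Permutations in one-line notation: lists of naturals.
-- [1..n]  (the identity permutation of {1,…,n})

idPerm : ℕ → List ℕ
idPerm n = map suc (upTo n)

-- Stack-sort, via the stack algorithm (equivalent to the recursive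
-- definition S(α m β) = S(α) S(β) m, as stated in the context).
-- The stack is a list with its top at the head.  Before pushing x, all
-- stack entries smaller than x (these form a prefix, since the stack is
-- increasing from top to bottom) are popped to the output.

stackRun : List ℕ → List ℕ → List ℕ
stackRun []       st = st
stackRun (x ∷ xs) st with span (λ y → y <? x) st
... | (small , rest) = small ++ stackRun xs (x ∷ rest)

S : List ℕ → List ℕ
S π = stackRun π []

-- Total indexing helpers (0-based `nth`, 1-based `val`), default 0.

nth : List ℕ → ℕ → ℕ
nth []       _       = 0
nth (x ∷ xs) zero    = x
nth (x ∷ xs) (suc i) = nth xs i

-- π(t) for 1 ≤ t ≤ length π
val : List ℕ → ℕ → ℕ
val π zero    = 0
val π (suc t) = nth π t

record DPattern : Set where
  constructor dpat
  field
    pat    : List ℕ            -- classical pattern p(1)…p(k), values 1..k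
    shaded : List (ℕ × ℕ)
    decr   : List (ℕ × ℕ)
open DPattern public

module _ (P : DPattern) (π : List ℕ) (is : List ℕ) where
  private
    n = length π
    k = length (pat P)

  Iext : List ℕ
  Iext = 0 ∷ is ++ [ suc n ]

  Vext : List ℕ
  Vext = 0 ∷ sort (map (val π) is) ++ [ suc n ]

  InBox : ℕ × ℕ → ℕ → Set
  InBox (a , b) t =
    (nth Iext a < t × t < nth Iext (suc a)) ×
    (nth Vext b < val π t × val π t < nth Vext (suc b))

  InRegion : List (ℕ × ℕ) → ℕ → Set
  InRegion D t = Σ (ℕ × ℕ) λ ab → ab ∈ D × InBox ab t

  IsClassicalOcc : Set
  IsClassicalOcc =
    length is ≡ k ×
    All (λ i → 1 ≤ i × i ≤ n) is ×
    AllPairs _<_ is ×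
    (∀ a b → a < k → b < k →
       (val π (nth is a) < val π (nth is b)) ⇔ (nth (pat P) a < nth (pat P) b))

  ShadedEmpty : Set
  ShadedEmpty = ∀ ab → ab ∈ shaded P → ∀ t → ¬ InBox ab t

  DecrRegion : Set
  DecrRegion = ∀ t t′ → InRegion (decr P) t → InRegion (decr P) t′ →
               t < t′ → val π t > val π t′

  IsOcc : Set
  IsOcc = IsClassicalOcc × ShadedEmpty × DecrRegion

Occurs : DPattern → List ℕ → Set
Occurs P π = Σ (List ℕ) λ is → IsOcc P π is

Avoids : DPattern → List ℕ → Set
Avoids P π = ¬ Occurs P π

westPatterns : List DPattern
westPatterns =
  dpat (2 ∷ 3 ∷ 4 ∷ 5 ∷ 1 ∷ []) [] [] ∷
  dpat (2 ∷ 4 ∷ 3 ∷ 5 ∷ 1 ∷ []) ((2 , 4) ∷ (2 , 5) ∷ []) [] ∷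
  dpat (3 ∷ 2 ∷ 4 ∷ 5 ∷ 1 ∷ []) ((1 , 3) ∷ (1 , 4) ∷ (1 , 5) ∷ []) [] ∷
  dpat (4 ∷ 2 ∷ 3 ∷ 5 ∷ 1 ∷ []) ((1 , 4) ∷ (1 , 5) ∷ (2 , 4) ∷ (2 , 5) ∷ []) [] ∷
  dpat (4 ∷ 3 ∷ 2 ∷ 5 ∷ 1 ∷ []) ((1 , 4) ∷ (1 , 5) ∷ (2 , 3) ∷ (2 , 4) ∷ (2 , 5) ∷ []) [] ∷
  dpat (3 ∷ 4 ∷ 2 ∷ 5 ∷ 1 ∷ []) ((1 , 3) ∷ (1 , 4) ∷ (1 , 5) ∷ (2 , 4) ∷ (2 , 5) ∷ []) [] ∷
  dpat (3 ∷ 6 ∷ 2 ∷ 4 ∷ 5 ∷ 1 ∷ [])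
       ((0 , 4) ∷ (0 , 5) ∷ (1 , 3) ∷ (1 , 4) ∷ (1 , 5) ∷ (1 , 6) ∷ (2 , 4) ∷ (2 , 6) ∷ [])
       ((2 , 5) ∷ []) ∷
  dpat (3 ∷ 6 ∷ 4 ∷ 2 ∷ 5 ∷ 1 ∷ [])
       ((0 , 4) ∷ (0 , 5) ∷ (1 , 3) ∷ (1 , 4) ∷ (1 , 5) ∷ (1 , 6) ∷ (2 , 4) ∷ (2 , 6) ∷
        (3 , 4) ∷ (3 , 5) ∷ (3 , 6) ∷ [])
       ((2 , 5) ∷ []) ∷
  dpat (7 ∷ 3 ∷ 6 ∷ 2 ∷ 4 ∷ 5 ∷ 1 ∷ [])
       ((1 , 4) ∷ (1 , 5) ∷ (1 , 6) ∷ (1 , 7) ∷ (2 , 3) ∷ (2 , 4) ∷ (2 , 5) ∷ (2 , 6) ∷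
        (2 , 7) ∷ (3 , 4) ∷ (3 , 6) ∷ (3 , 7) ∷ [])
       ((3 , 5) ∷ []) ∷
  dpat (7 ∷ 3 ∷ 6 ∷ 4 ∷ 2 ∷ 5 ∷ 1 ∷ [])
       ((1 , 4) ∷ (1 , 5) ∷ (1 , 6) ∷ (1 , 7) ∷ (2 , 3) ∷ (2 , 4) ∷ (2 , 5) ∷ (2 , 6) ∷
        (2 , 7) ∷ (3 , 4) ∷ (3 , 6) ∷ (3 , 7) ∷ (4 , 4) ∷ (4 , 5) ∷ (4 , 6) ∷ (4 , 7) ∷ [])
       ((3 , 5) ∷ []) ∷
  []

West3Sortable : ℕ → List ℕ → Set
West3Sortable n π = S (S (S π)) ≡ idPerm n

{-# OPTIONS --safe #-}
module Submission where

-- For values x < y, y precedes x in S π exactly when some z > y lies between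
-- them in π, i.e. y … z … x; all other pairs come out in increasing order.
-- Unfolding this three times, S (S (S π)) has an inversion (b , a) exactly when
-- there are a < b < c < d < e such that d, e, a occur in this order in π, c
-- precedes d in S π and b precedes c in S (S π) (an `Obstruction`).  Then b and
-- c precede e, and the six orders of b, c, d give the patterns 1–6, unless
-- entries larger than c lie between c and b.  Those entries are decreasing; let
-- m be the first.  If m < e it can replace d, which gives pattern 6, and
-- otherwise one gets 7–10, according to whether some entry below e can replace
-- d and whether an entry above m precedes c.  Conversely, if an occurrence of a
-- pattern is not itself an obstruction, the entries responsible for the failure
-- form another one.

open import Defs
open import Data.Nat using (ℕ; zero; suc; _<_; _≤_; _<?_; _≤?_; z≤n; s≤s; z<s; _>_)
open import Data.Nat.Properties using (≤-totalOrder; ≤-decTotalOrder; <⇒≤; <-trans; <-≤-trans; ≤-trans; ≮⇒≥; <⇒≱; <-irrefl; <⇒≢; <-cmp; ≤-pred; <-asym; n<1+n; m<n⇒0<n; m<1+n⇒m<n∨m≡n; m<n⇒m<1+n; >⇒≢)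
open import Data.List using (List; []; _∷_; _++_; map; length; upTo; takeWhile; dropWhile; [_])
open import Data.List.Properties using (span-defn; takeWhile++dropWhile; length-map; length-upTo)
open import Data.List.Membership.Propositional using (_∈_)
open import Data.List.Membership.Propositional.Properties using (∈-++⁺ˡ; ∈-++⁺ʳ; ∈-++⁻)
open import Data.List.Relation.Unary.All as All using (All; []; _∷_)
open import Data.List.Relation.Unary.All.Properties as All using (all-takeWhile; all-upTo; All¬⇒¬Any)
open import Data.List.Relation.Unary.Any using (Any; here; there)
open import Data.List.Relation.Unary.AllPairs as AllPairs using (AllPairs; []; _∷_)
open import Data.List.Relation.Unary.AllPairs.Properties as AllPairs using ()
open import Data.List.Relation.Unary.Linked as Linked using (Linked; []; [-]; _∷_)
open import Data.List.Relation.Unary.Linked.Properties as Linked using (Linked⇒AllPairs; AllPairs⇒Linked)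
open import Data.List.Relation.Unary.Unique.Propositional using (Unique)
open import Data.List.Relation.Unary.Sorted.TotalOrder.Properties using (↗↭↗⇒≋)
open import Data.List.Relation.Binary.Pointwise using (Pointwise-≡⇒≡)
open import Data.List.Relation.Binary.Permutation.Propositional using (_↭_; ↭-refl; ↭-sym; ↭-trans; ↭-reflexive; ↭⇒↭ₛ)
open import Data.List.Relation.Binary.Permutation.Propositional.Properties using (∈-resp-↭; All-resp-↭; ++⁺ˡ; shift; shifts; ++-comm; ↭-length; map⁺)
import Data.List.Relation.Binary.Permutation.Setoid.Properties as ↭ₛ
open import Data.Product using (Σ; ∃; ∃₂; _×_; _,_; proj₁; proj₂)
open import Data.Sum using (_⊎_; inj₁; inj₂; [_,_]′)
open import Data.Empty using (⊥; ⊥-elim)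
open import Function using (_∘_)
open import Relation.Unary using (Decidable)
open import Relation.Nullary using (¬_; yes; no)
open import Relation.Binary.Definitions using (tri<; tri≈; tri>)
open import Relation.Binary.PropositionalEquality using (_≡_; _≢_; refl; sym; trans; cong; subst; setoid)
open import Data.List.Sort.InsertionSort.Base ≤-decTotalOrder using (sort)
open import Data.List.Sort.InsertionSort.Properties ≤-decTotalOrder using (sort-↭; sort-↗)
open import Relation.Nullary.Decidable using (True; toWitness; _×-dec_)
open import Function.Bundles using (_⇔_; mk⇔; Equivalence)

-- Precedence of entries in a list

private variable
  x y z : ℕ
  xs ys st π : List ℕ

-- The relation compares values instead of positions, so that the same two entries can be followed
-- through π, S π, S² π and S³ π.
data Before (x y : ℕ) : List ℕ → Set where
  here  : y ∈ xs → Before x y (x ∷ xs)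
  there : Before x y xs → Before x y (z ∷ xs)

Before-∈ˡ : Before x y xs → x ∈ xs
Before-∈ˡ (here _)  = here refl
Before-∈ˡ (there p) = there (Before-∈ˡ p)

Before-∈ʳ : Before x y xs → y ∈ xs
Before-∈ʳ (here p)  = there p
Before-∈ʳ (there p) = there (Before-∈ʳ p)

Before-total : x ≢ y → x ∈ xs → y ∈ xs → Before x y xs ⊎ Before y x xs
Before-total x≢y (here refl) (here refl) = ⊥-elim (x≢y refl)
Before-total x≢y (here refl) (there q)   = inj₁ (here q)
Before-total x≢y (there p)   (here refl) = inj₂ (here p)
Before-total x≢y (there p)   (there q)   =
  [ inj₁ ∘ there , inj₂ ∘ there ]′ (Before-total x≢y p q)

Before-asym : Unique xs → Before x y xs → ¬ Before y x xs
Before-asym (h ∷ _) (here p)  (here _)  = All.lookup h p refl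
Before-asym (h ∷ _) (here p)  (there q) = All.lookup h (Before-∈ʳ q) refl
Before-asym (h ∷ _) (there p) (here _)  = All.lookup h (Before-∈ʳ p) refl
Before-asym (_ ∷ u) (there p) (there q) = Before-asym u p q

Before-AllPairs : ∀ {R : ℕ → ℕ → Set} → AllPairs R xs → Before x y xs → R x y
Before-AllPairs (h ∷ _) (here p)  = All.lookup h p
Before-AllPairs (_ ∷ r) (there p) = Before-AllPairs r p

AllPairs-Before : ∀ {R : ℕ → ℕ → Set} xs → (∀ {x y} → Before x y xs → R x y) → AllPairs R xs
AllPairs-Before []       f = []
AllPairs-Before (x ∷ xs) f = All.tabulate (f ∘ here) ∷ AllPairs-Before xs (f ∘ there)

Before-++ˡ : Before x y xs → Before x y (xs ++ ys)
Before-++ˡ (here p)  = here (∈-++⁺ˡ p)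
Before-++ˡ (there p) = there (Before-++ˡ p)

Before-++ˡʳ : ∀ {ys} → x ∈ xs → y ∈ ys → Before x y (xs ++ ys)
Before-++ˡʳ (here refl) q = here (∈-++⁺ʳ _ q)
Before-++ˡʳ (there p)   q = there (Before-++ˡʳ p q)

Before-++ʳ : ∀ xs → Before x y ys → Before x y (xs ++ ys)
Before-++ʳ []       p = p
Before-++ʳ (_ ∷ xs) p = there (Before-++ʳ xs p)

Before-++⁻ : ∀ xs → Before x y (xs ++ ys) →
             Before x y xs ⊎ (x ∈ xs × y ∈ ys) ⊎ Before x y ys
Before-++⁻ []       p         = inj₂ (inj₂ p)
Before-++⁻ (_ ∷ xs) (here p)  with ∈-++⁻ xs p
... | inj₁ q = inj₁ (here q)
... | inj₂ q = inj₂ (inj₁ (here refl , q))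
Before-++⁻ (_ ∷ xs) (there p) with Before-++⁻ xs p
... | inj₁ q              = inj₁ (there q)
... | inj₂ (inj₁ (q , r)) = inj₂ (inj₁ (there q , r))
... | inj₂ (inj₂ q)       = inj₂ (inj₂ q)

-- Stack sorting

-- The effect of pushing x onto the stack st: `small` is output, `rest` stays.
record Push (x : ℕ) (st : List ℕ) : Set where
  field
    small rest : List ℕ
    split      : st ≡ small ++ rest
    small<     : All (_< x) small
    sorted     : AllPairs _≤_ (x ∷ rest)
    run        : ∀ xs → stackRun (x ∷ xs) st ≡ small ++ stackRun xs (x ∷ rest)

-- The first entry kept is at least `x`, and the stack increases from there on. This keeps the stack
-- sorted when `x` is pushed.
dropWhile-≥ : ∀ {P : ℕ → Set} (P? : Decidable P) → (∀ {y} → ¬ P y → x ≤ y) → AllPairs _≤_ st →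
  AllPairs _≤_ (x ∷ dropWhile P? st)
dropWhile-≥ P? f [] = [] ∷ []
dropWhile-≥ {st = y ∷ st} P? f (h ∷ s) with P? y
... | yes _ = dropWhile-≥ P? f s
... | no ¬p = (f ¬p ∷ All.map (≤-trans (f ¬p)) h) ∷ h ∷ s

push : ∀ x st → AllPairs _≤_ st → Push x st
push x st s = record
  { small  = takeWhile small? st
  ; rest   = dropWhile small? st
  ; split  = sym (takeWhile++dropWhile small? st)
  ; small< = all-takeWhile small? st
  ; sorted = dropWhile-≥ small? ≮⇒≥ s
  ; run    = run
  }
  where
  small? = λ y → y <? x
  run : ∀ xs → stackRun (x ∷ xs) st ≡
               takeWhile small? st ++ stackRun xs (x ∷ dropWhile small? st)
  run xs rewrite span-defn small? st = refl

stackRun-↭ : ∀ xs st → AllPairs _≤_ st → stackRun xs st ↭ xs ++ st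
stackRun-↭ []       st s = ↭-refl
stackRun-↭ (x ∷ xs) st s = ↭-trans (↭-reflexive (run xs))
  (↭-trans (++⁺ˡ small (stackRun-↭ xs (x ∷ rest) sorted))
  (↭-trans (shifts small xs)
  (↭-trans (++⁺ˡ xs (shift x small rest))
  (↭-trans (shift x xs (small ++ rest))
           (↭-reflexive (cong (λ r → x ∷ xs ++ r) (sym split)))))))
  where open Push (push x st s)

∈-stackRunˡ : AllPairs _≤_ st → x ∈ xs → x ∈ stackRun xs st
∈-stackRunˡ s p = ∈-resp-↭ (↭-sym (stackRun-↭ _ _ s)) (∈-++⁺ˡ p)

S-↭ : ∀ π → S π ↭ π
S-↭ π = ↭-trans (stackRun-↭ π [] []) (++-comm π [])

Unique-resp-↭ : xs ↭ ys → Unique xs → Unique ys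
Unique-resp-↭ p = ↭ₛ.Unique-resp-↭ (setoid ℕ) (↭⇒↭ₛ p)

S-Unique : Unique π → Unique (S π)
S-Unique = Unique-resp-↭ (↭-sym (S-↭ _))

∈-S : x ∈ π → x ∈ S π
∈-S {π = π} = ∈-resp-↭ (↭-sym (S-↭ π))

-- The witness `z` is the entry whose arrival pops `y`. The induction needs an arbitrary stack, so
-- `y` may already lie on `st`, in which case it was read before every entry of `xs`.
stackRun-inversion⁻ : ∀ xs st → AllPairs _≤_ st → x < y → Before y x (stackRun xs st) →
  ∃ λ z → y < z × (y ∈ st ⊎ Before y z xs) × Before z x xs
stackRun-inversion⁻ []       st s x<y p = ⊥-elim (<⇒≱ x<y (Before-AllPairs s p))
stackRun-inversion⁻ {x} {y} (h ∷ t) st s x<y p = go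
  where
  open Push (push h st s)
  st-sorted : AllPairs _≤_ (small ++ rest)
  st-sorted = subst (AllPairs _≤_) split s
  in-st : ∀ {w} → w ∈ small ++ rest → w ∈ st
  in-st {w} = subst (w ∈_) (sym split)
  go : ∃ λ z → y < z × (y ∈ st ⊎ Before y z (h ∷ t)) × Before z x (h ∷ t)
  go with Before-++⁻ small (subst (Before y x) (run t) p)
  ... | inj₁ q = ⊥-elim (<⇒≱ x<y (Before-AllPairs st-sorted (Before-++ˡ q)))
  -- Here `h` pops `y` and `x` comes out later. Both `h` and the entries of `rest` are at least `y`,
  -- so `x` can only be an entry still to be read.
  ... | inj₂ (inj₁ (q , r)) with ∈-++⁻ t (∈-resp-↭ (stackRun-↭ t (h ∷ rest) sorted) r)
  ...   | inj₁ x∈t = h , All.lookup small< q , inj₁ (in-st (∈-++⁺ˡ q)) , here x∈t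
  ...   | inj₂ (here refl) = ⊥-elim (<-irrefl refl (<-trans x<y (All.lookup small< q)))
  ...   | inj₂ (there x∈rest) = ⊥-elim (<⇒≱ x<y (Before-AllPairs st-sorted (Before-++ˡʳ q x∈rest)))
  go | inj₂ (inj₂ q) with stackRun-inversion⁻ t (h ∷ rest) sorted x<y q
  ... | z , y<z , inj₁ (here refl)    , r = z , y<z , inj₂ (here (Before-∈ˡ r)) , there r
  ... | z , y<z , inj₁ (there y∈rest) , r = z , y<z , inj₁ (in-st (∈-++⁺ʳ small y∈rest)) , there r
  ... | z , y<z , inj₂ yz             , r = z , y<z , inj₂ (there yz) , there r

-- `y` leaves the stack at the latest when `z` is pushed, and `x` is read only after that. The
-- recursion runs until `y` is popped.
stackRun-inversion⁺ : ∀ xs st → AllPairs _≤_ st → Unique xs → x < y → y < z →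
  y ∈ st ⊎ Before y z xs → Before z x xs → Before y x (stackRun xs st)
stackRun-inversion⁺ {x} {y} {z} (h ∷ t) st s (h∉t ∷ u) x<y y<z yz zx =
  subst (Before y x) (sym (run t)) (go yz zx)
  where
  open Push (push h st s)
  popped : y ∈ small → x ∈ t → Before y x (small ++ stackRun t (h ∷ rest))
  popped p q = Before-++ˡʳ p (∈-stackRunˡ sorted q)
  later : y ∈ h ∷ rest ⊎ Before y z t → Before z x t →
          Before y x (small ++ stackRun t (h ∷ rest))
  later p q = Before-++ʳ small (stackRun-inversion⁺ t (h ∷ rest) sorted u x<y y<z p q)
  go : y ∈ st ⊎ Before y z (h ∷ t) → Before z x (h ∷ t) →
       Before y x (small ++ stackRun t (h ∷ rest))
  go (inj₁ p) q with ∈-++⁻ small (subst (y ∈_) split p)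
  go (inj₁ p) (here x∈t) | inj₁ r = popped r x∈t
  go (inj₁ p) (there q)  | inj₁ r = popped r (Before-∈ʳ q)
  go (inj₁ p) (here x∈t) | inj₂ r = ⊥-elim (<⇒≱ y<z (All.lookup (AllPairs.head sorted) r))
  go (inj₁ p) (there q)  | inj₂ r = later (inj₁ (there r)) q
  go (inj₂ (here z∈t))   (here _)  = ⊥-elim (<-irrefl refl y<z)
  go (inj₂ (here z∈t))   (there q) = later (inj₁ (here refl)) q
  go (inj₂ (there p))    (here _)  = ⊥-elim (All.lookup h∉t (Before-∈ʳ p) refl)
  go (inj₂ (there p))    (there q) = later (inj₂ p) q

S-inversion⁻ : x < y → Before y x (S π) → ∃ λ z → y < z × Before y z π × Before z x π
S-inversion⁻ {π = π} x<y p with stackRun-inversion⁻ π [] [] x<y p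
... | z , y<z , inj₂ q , r = z , y<z , q , r

S-inversion⁺ : Unique π → x < y → y < z → Before y z π → Before z x π → Before y x (S π)
S-inversion⁺ {π = π} u x<y y<z p q = stackRun-inversion⁺ π [] [] u x<y y<z (inj₂ p) q

-- Sorted lists

sorted-unique : Linked _≤_ xs → Linked _≤_ ys → xs ↭ ys → xs ≡ ys
sorted-unique p q r = Pointwise-≡⇒≡ (↗↭↗⇒≋ ≤-totalOrder p q (↭⇒↭ₛ r))

idPerm-increasing : ∀ n → AllPairs _<_ (idPerm n)
idPerm-increasing n = AllPairs.map⁺ (AllPairs.applyUpTo⁺₁ _ n (λ i<j _ → s≤s i<j))

no-inversion⇒sorted : ∀ {n} → xs ↭ idPerm n →
  (∀ {x y} → x < y → ¬ Before y x xs) → xs ≡ idPerm n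
no-inversion⇒sorted {xs = xs} p f = sorted-unique
  (AllPairs⇒Linked (AllPairs-Before xs λ b → ≮⇒≥ λ x<y → f x<y b))
  (AllPairs⇒Linked (AllPairs.map <⇒≤ (idPerm-increasing _))) p

-- Positions and values

val-∈ : ∀ π i → 0 < val π i → val π i ∈ π
val-∈ (x ∷ π) (suc zero)    p = here refl
val-∈ (x ∷ π) (suc (suc i)) p = there (val-∈ π (suc i) p)

∈-val : x ∈ π → ∃ λ i → val π (suc i) ≡ x
∈-val (here refl) = zero , refl
∈-val (there p) with ∈-val p
... | i , q = suc i , q

val-Before : ∀ π i j → 0 < val π i → 0 < val π j → i < j → Before (val π i) (val π j) π
val-Before (x ∷ π) (suc zero)    (suc (suc j)) p q _         = here (val-∈ π (suc j) q)
val-Before (x ∷ π) (suc (suc i)) (suc (suc j)) p q (s≤s i<j) = there (val-Before π (suc i) (suc j) p q i<j)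
val-Before (x ∷ π) (suc i)       (suc zero)    p q (s≤s ())

Before-val : Before x y π → ∃₂ λ i j → i < j × val π (suc i) ≡ x × val π (suc j) ≡ y
Before-val (here p) with ∈-val p
... | j , q = zero , suc j , z<s , refl , q
Before-val (there p) with Before-val p
... | i , j , i<j , q , r = suc i , suc j , s≤s i<j , q , r

-- `val` is 0 outside the list, so a positive value can only come from a valid position. Throughout,
-- `0 < val π i` stands for the validity of `i`.
val-range : ∀ π i → 0 < val π i → 1 ≤ i × i ≤ length π
val-range (x ∷ π) (suc zero)    p = s≤s z≤n , s≤s z≤n
val-range (x ∷ π) (suc (suc i)) p = s≤s z≤n , s≤s (proj₂ (val-range π (suc i) p))

val-positive : ∀ π → All (0 <_) π → ∀ i → 1 ≤ i → i ≤ length π → 0 < val π i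
val-positive (x ∷ π) (p ∷ _)  (suc zero)    _ _         = p
val-positive (x ∷ π) (_ ∷ ps) (suc (suc i)) _ (s≤s i≤n) = val-positive π ps (suc i) (s≤s z≤n) i≤n

val-injective : ∀ π → Unique π → ∀ i j → 0 < val π i → val π i ≡ val π j → i ≡ j
val-injective π u i j p eq with <-cmp i j
... | tri≈ _ i≡j _ = i≡j
... | tri< i<j _ _ = ⊥-elim (Before-AllPairs u (val-Before π i j p (subst (0 <_) eq p) i<j) eq)
... | tri> _ _ j<i = ⊥-elim (Before-AllPairs u (val-Before π j i (subst (0 <_) eq p) p j<i) (sym eq))

-- The condition `f 0 ≡ 0` makes the default of `nth` agree on both sides beyond the end of the
-- list.
nth-map : ∀ (f : ℕ → ℕ) → f 0 ≡ 0 → ∀ xs i → nth (map f xs) i ≡ f (nth xs i)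
nth-map f f0 []       i       = sym f0
nth-map f f0 (x ∷ xs) zero    = refl
nth-map f f0 (x ∷ xs) (suc i) = nth-map f f0 xs i

nth-∈ : ∀ xs i → i < length xs → nth xs i ∈ xs
nth-∈ (x ∷ xs) zero    _         = here refl
nth-∈ (x ∷ xs) (suc i) (s≤s i<n) = there (nth-∈ xs i i<n)

nth-mono : AllPairs _<_ xs → ∀ i j → i < j → j < length xs → nth xs i < nth xs j
nth-mono (h ∷ _) zero    (suc j) _         (s≤s j<n) = All.lookup h (nth-∈ _ j j<n)
nth-mono (_ ∷ p) (suc i) (suc j) (s≤s i<j) (s≤s j<n) = nth-mono p i j i<j j<n

nth-mono-⇔ : AllPairs _<_ xs → ∀ i j → i < length xs → j < length xs →
             (nth xs i < nth xs j) ⇔ (i < j)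
nth-mono-⇔ {xs = xs} p i j i<n j<n = mk⇔ from (λ i<j → nth-mono p i j i<j j<n)
  where
  from : nth xs i < nth xs j → i < j
  from q with <-cmp i j
  ... | tri< i<j _ _  = i<j
  ... | tri≈ _ refl _ = ⊥-elim (<-irrefl refl q)
  ... | tri> _ _ j<i  = ⊥-elim (<-asym q (nth-mono p j i j<i i<n))

-- Pattern occurrences with sorted values

module Occurrences (π : List ℕ) where

  private
    v : ℕ → ℕ
    v = val π
    n : ℕ
    n = length π

  -- A pattern occurrence with its values vs already sorted, so that the
  -- box conditions compute when is and vs are explicit lists.
  Box : List ℕ → List ℕ → ℕ × ℕ → ℕ → Set
  Box is vs (a , b) t =
    (nth (0 ∷ is ++ [ suc n ]) a < t × t < nth (0 ∷ is ++ [ suc n ]) (suc a)) ×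
    (nth (0 ∷ vs ++ [ suc n ]) b < v t × v t < nth (0 ∷ vs ++ [ suc n ]) (suc b))

  -- For a concrete pattern, `empty` becomes a list with one function per shaded box. The nested
  -- `All` in `decreasing` covers entries from two different boxes of the region. The 0 in front of
  -- `vs` makes all values positive.
  record Occurrence (P : DPattern) (is vs : List ℕ) : Set where
    constructor occurrence
    field
      positions  : Linked _<_ is
      values     : Linked _<_ (0 ∷ vs)
      empty      : All (λ ab → ∀ t → ¬ Box is vs ab t) (shaded P)
      decreasing : All (λ ab → All (λ ab′ → ∀ t t′ →
                     Box is vs ab t → Box is vs ab′ t′ → t < t′ → v t > v t′) (decr P)) (decr P)

  -- All three equations hold by `refl` once `is` and `vs` are written out. The last says that
  -- position number i carries the p(i)-th smallest value; the 0 in front of `vs` turns the 0-based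
  -- `nth` into a 1-based lookup.
  module _ (P : DPattern) (is vs : List ℕ)
    (perm : sort (pat P) ≡ idPerm (length vs))
    (vs≡ : map (nth (0 ∷ vs)) (idPerm (length vs)) ≡ vs)
    (is≡ : map v is ≡ map (nth (0 ∷ vs)) (pat P)) where

    map-↭ : map v is ↭ vs
    map-↭ = ↭-trans (↭-reflexive is≡) (↭-trans (map⁺ (nth (0 ∷ vs)) pat↭) (↭-reflexive vs≡))
      where
      pat↭ : pat P ↭ idPerm (length vs)
      pat↭ = ↭-trans (↭-sym (sort-↭ (pat P))) (↭-reflexive perm)

    sort-values : Linked _<_ (0 ∷ vs) → sort (map v is) ≡ vs
    sort-values p = sorted-unique (sort-↗ (map v is)) (Linked.map <⇒≤ (Linked.tail p))
      (↭-trans (sort-↭ (map v is)) map-↭)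

    occurs : length is ≡ length (pat P) → {True (All.all? (_≤? length vs) (pat P))} →
             Occurrence P is vs → Occurs P π
    occurs len {le} o = is , (len , range , Linked⇒AllPairs <-trans positions , order) ,
                        subst Empty (sym sorted) empty′ , subst Decreasing (sym sorted) decreasing′
      where
      open Occurrence o
      sorted : sort (map v is) ≡ vs
      sorted = sort-values values
      range : All (λ i → 1 ≤ i × i ≤ n) is
      -- The values in `vs` are positive, and positive values occur only at positions in range.
      range = All.map (λ {i} → val-range π i)
        (All.map⁻ (All-resp-↭ (↭-sym map-↭) (AllPairs.head (Linked⇒AllPairs <-trans values))))
      v-nth : ∀ i → v (nth is i) ≡ nth (0 ∷ vs) (nth (pat P) i)
      v-nth i = trans (sym (nth-map v refl is i))
        (trans (cong (λ l → nth l i) is≡) (nth-map (nth (0 ∷ vs)) refl (pat P) i))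
      nth< : ∀ i → i < length (pat P) → nth (pat P) i < length (0 ∷ vs)
      nth< i i<k = s≤s (All.lookup (toWitness le) (nth-∈ (pat P) i i<k))
      order : ∀ a b → a < length (pat P) → b < length (pat P) →
              (v (nth is a) < v (nth is b)) ⇔ (nth (pat P) a < nth (pat P) b)
      order a b a<k b<k rewrite v-nth a | v-nth b =
        nth-mono-⇔ (Linked⇒AllPairs <-trans values) _ _ (nth< a a<k) (nth< b b<k)
      Empty Decreasing : List ℕ → Set
      Empty ws = ∀ ab → ab ∈ shaded P → ∀ t → ¬ Box is ws ab t
      Decreasing ws = ∀ t t′ → Σ (ℕ × ℕ) (λ ab → ab ∈ decr P × Box is ws ab t) →
        Σ (ℕ × ℕ) (λ ab → ab ∈ decr P × Box is ws ab t′) → t < t′ → v t > v t′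
      empty′ : Empty vs
      empty′ ab ab∈ = All.lookup empty ab∈
      decreasing′ : Decreasing vs
      decreasing′ t t′ (ab , p , q) (ab′ , p′ , q′) =
        All.lookup (All.lookup decreasing p) p′ t t′ q q′

    occurrence⁻ : Linked _<_ (0 ∷ vs) → IsOcc P π is → Occurrence P is vs
    occurrence⁻ values ((_ , _ , positions , _) , empty , decreasing)
      -- Abstracting the sorted list lets `refl` replace it by `vs` in all box conditions.
      with sort (map v is) | sort-values values
    ... | _ | refl = occurrence (AllPairs⇒Linked positions) values
      (All.tabulate (λ {ab} → empty ab))
      (All.tabulate λ {ab} p → All.tabulate λ {ab′} p′ t t′ q q′ →
        decreasing t t′ (ab , p , q) (ab′ , p′ , q′))

  private
    Ascends? : ∀ P q r → _
    Ascends? P q r = (nth (pat P) q <? nth (pat P) r) ×-dec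
      ((q <? length (pat P)) ×-dec (r <? length (pat P)))

  -- q ∷ qs lists the 0-based positions of the pattern by increasing value.
  increasing-values : All (0 <_) π → ∀ P is q qs →
    {True (q <? length (pat P))} → {True (Linked.linked? (Ascends? P) (q ∷ qs))} →
    IsClassicalOcc P π is → Linked _<_ (0 ∷ map (λ r → v (nth is r)) (q ∷ qs))
  increasing-values pos P is q qs {q<} {asc} (len , range , _ , order) =
    positive (All.lookup range (nth-∈ is q (subst (q <_) (sym len) (toWitness q<)))) ∷
    Linked.map⁺ (Linked.map
      (λ { (lt , a<k , b<k) → Equivalence.from (order _ _ a<k b<k) lt }) (toWitness asc))
    where
    positive : 1 ≤ nth is q × nth is q ≤ n → 0 < v (nth is q)
    positive (lo , hi) = val-positive π pos (nth is q) lo hi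

-- Bounded search

least : ∀ {P : ℕ → Set} → Decidable P → ∀ N →
        (∀ t → t < N → ¬ P t) ⊎ ∃ λ t → t < N × P t × (∀ s → s < t → ¬ P s)
least P? zero = inj₁ λ _ ()
least P? (suc N) with least P? N
... | inj₂ (t , t<N , rest) = inj₂ (t , m<n⇒m<1+n t<N , rest)
... | inj₁ none with P? N
...   | yes p = inj₂ (N , n<1+n N , p , none)
...   | no ¬p = inj₁ λ t t<1+N p → [ (λ t<N → none t t<N p) , (λ { refl → ¬p p }) ]′ (m<1+n⇒m<n∨m≡n t<1+N)

greatest : ∀ {P : ℕ → Set} → Decidable P → ∀ N →
           (∀ t → t < N → ¬ P t) ⊎ ∃ λ t → t < N × P t × (∀ s → t < s → s < N → ¬ P s)
greatest P? zero = inj₁ λ _ ()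
greatest P? (suc N) with P? N
... | yes p = inj₂ (N , n<1+n N , p , λ s N<s s<1+N _ → <⇒≱ N<s (≤-pred s<1+N))
... | no ¬p with greatest P? N
...   | inj₁ none = inj₁ λ t t<1+N p → [ (λ t<N → none t t<N p) , (λ { refl → ¬p p }) ]′ (m<1+n⇒m<n∨m≡n t<1+N)
...   | inj₂ (t , t<N , p , last) = inj₂ (t , m<n⇒m<1+n t<N , p , λ s t<s s<1+N q →
        [ (λ s<N → last s t<s s<N q) , (λ { refl → ¬p q }) ]′ (m<1+n⇒m<n∨m≡n s<1+N))

private
  P₁ P₂ P₃ P₄ P₅ P₆ P₇ P₈ P₉ P₁₀ : DPattern
  P₁ = dpat (2 ∷ 3 ∷ 4 ∷ 5 ∷ 1 ∷ []) [] []
  P₂ = dpat (2 ∷ 4 ∷ 3 ∷ 5 ∷ 1 ∷ []) ((2 , 4) ∷ (2 , 5) ∷ []) []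
  P₃ = dpat (3 ∷ 2 ∷ 4 ∷ 5 ∷ 1 ∷ []) ((1 , 3) ∷ (1 , 4) ∷ (1 , 5) ∷ []) []
  P₄ = dpat (4 ∷ 2 ∷ 3 ∷ 5 ∷ 1 ∷ []) ((1 , 4) ∷ (1 , 5) ∷ (2 , 4) ∷ (2 , 5) ∷ []) []
  P₅ = dpat (4 ∷ 3 ∷ 2 ∷ 5 ∷ 1 ∷ [])
    ((1 , 4) ∷ (1 , 5) ∷ (2 , 3) ∷ (2 , 4) ∷ (2 , 5) ∷ []) []
  P₆ = dpat (3 ∷ 4 ∷ 2 ∷ 5 ∷ 1 ∷ [])
    ((1 , 3) ∷ (1 , 4) ∷ (1 , 5) ∷ (2 , 4) ∷ (2 , 5) ∷ []) []
  P₇ = dpat (3 ∷ 6 ∷ 2 ∷ 4 ∷ 5 ∷ 1 ∷ [])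
    ((0 , 4) ∷ (0 , 5) ∷ (1 , 3) ∷ (1 , 4) ∷ (1 , 5) ∷ (1 , 6) ∷ (2 , 4) ∷ (2 , 6) ∷ [])
    ((2 , 5) ∷ [])
  P₈ = dpat (3 ∷ 6 ∷ 4 ∷ 2 ∷ 5 ∷ 1 ∷ [])
    ((0 , 4) ∷ (0 , 5) ∷ (1 , 3) ∷ (1 , 4) ∷ (1 , 5) ∷ (1 , 6) ∷ (2 , 4) ∷ (2 , 6) ∷
    (3 , 4) ∷ (3 , 5) ∷ (3 , 6) ∷ [])
    ((2 , 5) ∷ [])
  P₉ = dpat (7 ∷ 3 ∷ 6 ∷ 2 ∷ 4 ∷ 5 ∷ 1 ∷ [])
    ((1 , 4) ∷ (1 , 5) ∷ (1 , 6) ∷ (1 , 7) ∷ (2 , 3) ∷ (2 , 4) ∷ (2 , 5) ∷ (2 , 6) ∷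
    (2 , 7) ∷ (3 , 4) ∷ (3 , 6) ∷ (3 , 7) ∷ [])
    ((3 , 5) ∷ [])
  P₁₀ = dpat (7 ∷ 3 ∷ 6 ∷ 4 ∷ 2 ∷ 5 ∷ 1 ∷ [])
    ((1 , 4) ∷ (1 , 5) ∷ (1 , 6) ∷ (1 , 7) ∷ (2 , 3) ∷ (2 , 4) ∷ (2 , 5) ∷ (2 , 6) ∷
    (2 , 7) ∷ (3 , 4) ∷ (3 , 6) ∷ (3 , 7) ∷ (4 , 4) ∷ (4 , 5) ∷ (4 , 6) ∷ (4 , 7) ∷ [])
    ((3 , 5) ∷ [])

-- Obstructions in a permutation

module Characterisation (π : List ℕ) (π-unique : Unique π)
  (π-range : All (λ x → 0 < x × x ≤ length π) π) where

  open Occurrences π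

  private
    v : ℕ → ℕ
    v = val π

  π-positive : All (0 <_) π
  π-positive = All.map proj₁ π-range

  -- For v c < v d: the entry at position c precedes the one at d in S π.
  SBefore : ℕ → ℕ → Set
  SBefore c d = ∀ f → d < f → f < c → ¬ v d < v f

  -- For v b < v c: the entry at position b precedes the one at c in S (S π).
  S²Before : ℕ → ℕ → Set
  S²Before b c = ∀ z w → v c < v z → SBefore c z → z < w → w < b → ¬ v z < v w

  -- The positions a and b of an inversion of S (S (S π)), with c, d, e the
  -- witnesses for the inversions (b , a), (c , a), (d , a) of S³ π, S² π, S π.
  record Obstruction : Set where
    constructor obstruction
    field
      {a b c d e} : ℕ
      values : Linked _<_ (0 ∷ v a ∷ v b ∷ v c ∷ v d ∷ v e ∷ [])
      d<e    : d < e
      e<a    : e < a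
      c-d    : SBefore c d
      b-c    : S²Before b c

  <⇒SBefore : ∀ {c d} → c < d → SBefore c d
  <⇒SBefore c<d f d<f f<c = ⊥-elim (<-asym c<d (<-trans d<f f<c))

  -- Suppose `z` and `w` violate the conclusion. If `w` is after `c`, it lies between `c` and `b`
  -- and exceeds `c`, against `b-c`. If it is before `c`, it contradicts `c-z`.
  SBefore⇒S²Before : ∀ {b c} → SBefore b c → S²Before b c
  SBefore⇒S²Before {b} {c} b-c z w c<z c-z z<w w<b vz<vw with <-cmp c w
  ... | tri< c<w _ _  = b-c w c<w w<b (<-trans c<z vz<vw)
  ... | tri≈ _ refl _ = <-asym c<z vz<vw
  ... | tri> _ _ w<c  = c-z w z<w w<c vz<vw

  order : ∀ {i j} → v i < v j → i < j ⊎ j < i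
  order {i} {j} vi<vj with <-cmp i j
  ... | tri< i<j _ _  = inj₁ i<j
  ... | tri≈ _ refl _ = ⊥-elim (<-irrefl refl vi<vj)
  ... | tri> _ _ j<i  = inj₂ j<i

  compare : ∀ t k → t ≢ k → 0 < v k → v t < v k ⊎ v k < v t
  compare t k t≢k 0<vk with <-cmp (v t) (v k)
  ... | tri< lt _ _ = inj₁ lt
  ... | tri≈ _ eq _ = ⊥-elim (t≢k (sym (val-injective π π-unique k t 0<vk (sym eq))))
  ... | tri> _ _ gt = inj₂ gt

  -- Supplies the upper border n+1 of the top row of boxes.
  val<1+n : ∀ t → 0 < v t → v t < suc (length π)
  val<1+n t p = s≤s (proj₂ (All.lookup π-range (val-∈ π t p)))

  -- Supplies the left border 0 of the first column of boxes.
  0<val⇒0< : ∀ t → 0 < v t → 0 < t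
  0<val⇒0< t p = proj₁ (val-range π t p)

  -- Every pattern obstructs

  module _ (no-obstruction : ¬ Obstruction) where

    -- Serves the patterns in which `b` precedes `c` already in S π.
    simple : ∀ {a b c d e} → Linked _<_ (0 ∷ v a ∷ v b ∷ v c ∷ v d ∷ v e ∷ []) →
             d < e → e < a → SBefore c d → SBefore b c → ⊥
    simple vs d<e e<a c-d b-c =
      no-obstruction (obstruction vs d<e e<a c-d (SBefore⇒S²Before b-c))

    increasing : ∀ {a b c d e} → Linked _<_ (0 ∷ v a ∷ v b ∷ v c ∷ v d ∷ v e ∷ []) →
                 b < c → c < d → d < e → e < a → ⊥
    increasing vs b<c c<d d<e e<a = simple vs d<e e<a (<⇒SBefore c<d) (<⇒SBefore b<c)

    -- If b does not precede c in S² π, the witnesses z and w of this failure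
    -- obstruct in the role of one of b, c, d, unless they have one of the
    -- two forms below.
    c-before-d : ∀ {a b c d e} → Linked _<_ (0 ∷ v a ∷ v b ∷ v c ∷ v d ∷ v e ∷ []) →
      c < d → b < e → d < e → e < a →
      (∀ z w → v c < v z → v z < v w → c < z → z < w → w < b → ⊥) →
      (∀ z w → v d < v z → v z < v w → z < c → c < w → w < b → SBefore c z → ⊥) → ⊥
    c-before-d {a} {b} {c} {d} {e} vs@(0<a ∷ a<b ∷ b<c ∷ vc<vd ∷ vd<ve ∷ [-])
      c<d b<e d<e e<a after before =
      no-obstruction (obstruction vs d<e e<a (<⇒SBefore c<d) b-c)
      where
      b-c : S²Before b c
      b-c z w vc<vz c-z z<w w<b vz<vw with order vc<vz
      ... | inj₁ c<z = after z w vc<vz vz<vw c<z z<w w<b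
      ... | inj₂ z<c with compare z d (<⇒≢ (<-trans z<c c<d)) (<-trans 0<a (<-trans a<b (<-trans b<c vc<vd)))
      -- Now `c` and `z` take over the roles of `b` and `c`, with `d` kept: `z` stands before `d`,
      -- and `c-z` provides the remaining condition.
      ...   | inj₁ vz<vd = simple (0<a ∷ <-trans a<b b<c ∷ vc<vz ∷ vz<vd ∷ vd<ve ∷ [-]) d<e e<a
                (<⇒SBefore (<-trans z<c c<d)) c-z
      ...   | inj₂ vd<vz with order (<-trans vc<vz vz<vw)
      ...     | inj₁ c<w = before z w vd<vz vz<vw z<c c<w w<b c-z
      ...     | inj₂ w<c = c-z w z<w w<c vz<vw

    obstructs₁ : ∀ {a b c d e} →
      Occurrence P₁ (b ∷ c ∷ d ∷ e ∷ a ∷ []) (v a ∷ v b ∷ v c ∷ v d ∷ v e ∷ []) → ⊥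
    obstructs₁ {a} {b} {c} {d} {e} (occurrence (b<c ∷ c<d ∷ d<e ∷ e<a ∷ [-]) vs _ _) = increasing vs b<c c<d d<e e<a

    -- The two shaded boxes together form the region above `d` between `d` and `c`, and its
    -- emptiness is `SBefore c d`.
    obstructs₂ : ∀ {a b c d e} →
      Occurrence P₂ (b ∷ d ∷ c ∷ e ∷ a ∷ []) (v a ∷ v b ∷ v c ∷ v d ∷ v e ∷ []) → ⊥
    obstructs₂ {a} {b} {c} {d} {e} (occurrence (b<d ∷ d<c ∷ c<e ∷ e<a ∷ [-]) vs@(_ ∷ _ ∷ _ ∷ vc<vd ∷ vd<ve ∷ [-])
            (e24 ∷ e25 ∷ []) _) =
      simple vs (<-trans d<c c<e) e<a c-d (<⇒SBefore (<-trans b<d d<c))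
      where
      c-d : SBefore c d
      c-d t d<t t<c vd<vt with compare t e (<⇒≢ (<-trans t<c c<e)) (m<n⇒0<n vd<ve)
      ... | inj₁ vt<ve = e24 t ((d<t , t<c) , vd<vt , vt<ve)
      ... | inj₂ ve<vt = e25 t ((d<t , t<c) , ve<vt , val<1+n t (m<n⇒0<n ve<vt))

    -- Column 1 is empty above `c`, which is `SBefore b c`.
    obstructs₃ : ∀ {a b c d e} →
      Occurrence P₃ (c ∷ b ∷ d ∷ e ∷ a ∷ []) (v a ∷ v b ∷ v c ∷ v d ∷ v e ∷ []) → ⊥
    obstructs₃ {a} {b} {c} {d} {e} (occurrence (c<b ∷ b<d ∷ d<e ∷ e<a ∷ [-]) vs@(_ ∷ _ ∷ _ ∷ vc<vd ∷ vd<ve ∷ [-])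
            (e13 ∷ e14 ∷ e15 ∷ []) _) =
      simple vs d<e e<a (<⇒SBefore (<-trans c<b b<d)) b-c
      where
      b-c : SBefore b c
      b-c t c<t t<b vc<vt with compare t d (<⇒≢ (<-trans t<b b<d)) (m<n⇒0<n vc<vd)
      ... | inj₁ vt<vd = e13 t ((c<t , t<b) , vc<vt , vt<vd)
      ... | inj₂ vd<vt with compare t e (<⇒≢ (<-trans t<b (<-trans b<d d<e))) (m<n⇒0<n vd<ve)
      ...   | inj₁ vt<ve = e14 t ((c<t , t<b) , vd<vt , vt<ve)
      ...   | inj₂ ve<vt = e15 t ((c<t , t<b) , ve<vt , val<1+n t (m<n⇒0<n ve<vt))

    obstructs₄ : ∀ {a b c d e} →
      Occurrence P₄ (d ∷ b ∷ c ∷ e ∷ a ∷ []) (v a ∷ v b ∷ v c ∷ v d ∷ v e ∷ []) → ⊥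
    obstructs₄ {a} {b} {c} {d} {e} (occurrence (d<b ∷ b<c ∷ c<e ∷ e<a ∷ [-]) vs@(_ ∷ _ ∷ vb<vc ∷ vc<vd ∷ vd<ve ∷ [-])
            (e14 ∷ e15 ∷ e24 ∷ e25 ∷ []) _) =
      simple vs (<-trans d<b (<-trans b<c c<e)) e<a c-d (<⇒SBefore b<c)
      where
      c-d : SBefore c d
      -- `t` is in column 1 or 2 according to its side of `b`; it is not `b` itself, whose value is
      -- below that of `d`.
      c-d t d<t t<c vd<vt with order (<-trans (<-trans vb<vc vc<vd) vd<vt) | compare t e (<⇒≢ (<-trans t<c c<e)) (m<n⇒0<n vd<ve)
      ... | inj₂ t<b | inj₁ vt<ve = e14 t ((d<t , t<b) , vd<vt , vt<ve)
      ... | inj₂ t<b | inj₂ ve<vt = e15 t ((d<t , t<b) , ve<vt , val<1+n t (m<n⇒0<n ve<vt))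
      ... | inj₁ b<t | inj₁ vt<ve = e24 t ((b<t , t<c) , vd<vt , vt<ve)
      ... | inj₁ b<t | inj₂ ve<vt = e25 t ((b<t , t<c) , ve<vt , val<1+n t (m<n⇒0<n ve<vt))

    obstructs₅ : ∀ {a b c d e} →
      Occurrence P₅ (d ∷ c ∷ b ∷ e ∷ a ∷ []) (v a ∷ v b ∷ v c ∷ v d ∷ v e ∷ []) → ⊥
    obstructs₅ {a} {b} {c} {d} {e} (occurrence (d<c ∷ c<b ∷ b<e ∷ e<a ∷ [-]) vs@(_ ∷ _ ∷ vb<vc ∷ vc<vd ∷ vd<ve ∷ [-])
            (e14 ∷ e15 ∷ e23 ∷ e24 ∷ e25 ∷ []) _) =
      simple vs (<-trans d<c (<-trans c<b b<e)) e<a c-d b-c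
      where
      c-d : SBefore c d
      c-d t d<t t<c vd<vt with compare t e (<⇒≢ (<-trans t<c (<-trans c<b b<e))) (m<n⇒0<n vd<ve)
      ... | inj₁ vt<ve = e14 t ((d<t , t<c) , vd<vt , vt<ve)
      ... | inj₂ ve<vt = e15 t ((d<t , t<c) , ve<vt , val<1+n t (m<n⇒0<n ve<vt))
      b-c : SBefore b c
      b-c t c<t t<b vc<vt with compare t d (>⇒≢ (<-trans d<c c<t)) (m<n⇒0<n vc<vd)
      ... | inj₁ vt<vd = e23 t ((c<t , t<b) , vc<vt , vt<vd)
      ... | inj₂ vd<vt with compare t e (<⇒≢ (<-trans t<b b<e)) (m<n⇒0<n vd<ve)
      ...   | inj₁ vt<ve = e24 t ((c<t , t<b) , vd<vt , vt<ve)
      ...   | inj₂ ve<vt = e25 t ((c<t , t<b) , ve<vt , val<1+n t (m<n⇒0<n ve<vt))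

    -- Nothing in column 1 exceeds `c` and nothing in column 2 exceeds `d`. Failing witnesses with
    -- `z` after `c` could only form a 23451 on `c`, `z`, `w`, `e`, `a`; with `z` before `c` and
    -- above `d` there is no place for `w`.
    obstructs₆ : ∀ {a b c d e} →
      Occurrence P₆ (c ∷ d ∷ b ∷ e ∷ a ∷ []) (v a ∷ v b ∷ v c ∷ v d ∷ v e ∷ []) → ⊥
    obstructs₆ {a} {b} {c} {d} {e} (occurrence (c<d ∷ d<b ∷ b<e ∷ e<a ∷ [-]) vs@(0<a ∷ a<b ∷ vb<vc ∷ vc<vd ∷ vd<ve ∷ [-])
            (e13 ∷ e14 ∷ e15 ∷ e24 ∷ e25 ∷ []) _) =
      c-before-d vs c<d b<e (<-trans d<b b<e) e<a after before
      where
      col1 : ∀ t → c < t → t < d → ¬ v c < v t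
      col1 t c<t t<d vc<vt with compare t d (<⇒≢ t<d) (m<n⇒0<n vc<vd)
      ... | inj₁ vt<vd = e13 t ((c<t , t<d) , vc<vt , vt<vd)
      ... | inj₂ vd<vt with compare t e (<⇒≢ (<-trans t<d (<-trans d<b b<e))) (m<n⇒0<n vd<ve)
      ...   | inj₁ vt<ve = e14 t ((c<t , t<d) , vd<vt , vt<ve)
      ...   | inj₂ ve<vt = e15 t ((c<t , t<d) , ve<vt , val<1+n t (m<n⇒0<n ve<vt))
      col2 : ∀ t → d < t → t < b → ¬ v d < v t
      col2 t d<t t<b vd<vt with compare t e (<⇒≢ (<-trans t<b b<e)) (m<n⇒0<n vd<ve)
      ... | inj₁ vt<ve = e24 t ((d<t , t<b) , vd<vt , vt<ve)
      ... | inj₂ ve<vt = e25 t ((d<t , t<b) , ve<vt , val<1+n t (m<n⇒0<n ve<vt))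
      after : ∀ z w → v c < v z → v z < v w → c < z → z < w → w < b → ⊥
      after z w vc<vz vz<vw c<z z<w w<b with <-cmp z d
      ... | tri< z<d _ _  = col1 z c<z z<d vc<vz
      ... | tri≈ _ refl _ = col2 w z<w w<b vz<vw
      ... | tri> _ _ d<z with compare w d (>⇒≢ (<-trans d<z z<w)) (m<n⇒0<n vc<vd)
      ...   | inj₁ vw<vd = increasing
                (0<a ∷ <-trans a<b vb<vc ∷ vc<vz ∷ vz<vw ∷ <-trans vw<vd vd<ve ∷ [-])
                c<z z<w (<-trans w<b b<e) e<a
      ...   | inj₂ vd<vw = col2 w (<-trans d<z z<w) w<b vd<vw
      before : ∀ z w → v d < v z → v z < v w → z < c → c < w → w < b → SBefore c z → ⊥
      before z w vd<vz vz<vw z<c c<w w<b _ with order (<-trans vd<vz vz<vw)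
      ... | inj₂ w<d = col1 w c<w w<d (<-trans vc<vd (<-trans vd<vz vz<vw))
      ... | inj₁ d<w = col2 w d<w w<b (<-trans vd<vz vz<vw)

    -- The entry m > e between c and b is what the patterns 7–10 share.
    spike : ∀ {a b c d e m} → Linked _<_ (0 ∷ v a ∷ v b ∷ v c ∷ v d ∷ v e ∷ v m ∷ []) →
      c < m → m < d → m < b → b < e → d < e → e < a →
      (∀ t → c < t → t < m → ¬ v c < v t) →
      (∀ t → m < t → t < b → ¬ v m < v t) →
      (∀ t → m < t → t < b → v d < v t → ¬ v t < v e) →
      (∀ t → d < t → t < b → ¬ v e < v t) →
      (∀ t t′ → m < t → t′ < b → v e < v t → v t′ < v m → t < t′ → ¬ v t < v t′) →
      (∀ z → z < c → v d < v z → v z < v m → ¬ SBefore c z) → ⊥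
    spike {a} {b} {c} {d} {e} {m} (0<a ∷ a<b ∷ vb<vc ∷ vc<vd ∷ vd<ve ∷ ve<vm ∷ [-])
      c<m m<d m<b b<e d<e e<a c-m >m d-e d-b decr before =
      c-before-d (0<a ∷ a<b ∷ vb<vc ∷ vc<vd ∷ vd<ve ∷ [-]) (<-trans c<m m<d) b<e d<e e<a after
        (λ z w vd<vz vz<vw z<c c<w w<b →
          before z z<c vd<vz (<-≤-trans vz<vw (≮⇒≥ (≤m w (<-trans vc<vd (<-trans vd<vz vz<vw)) c<w w<b))))
      where
      0<m : 0 < v m
      0<m = m<n⇒0<n ve<vm
      ≤m : ∀ w → v c < v w → c < w → w < b → ¬ v m < v w
      ≤m w vc<vw c<w w<b vm<vw with order vm<vw
      ... | inj₁ m<w = >m w m<w w<b vm<vw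
      ... | inj₂ w<m = c-m w c<w w<m vc<vw
      after : ∀ z w → v c < v z → v z < v w → c < z → z < w → w < b → ⊥
      after z w vc<vz vz<vw c<z z<w w<b with <-cmp z m
      ... | tri< z<m _ _  = c-m z c<z z<m vc<vz
      ... | tri≈ _ refl _ = >m w z<w w<b vz<vw
      -- By value: `d-e` excludes `z` between `d` and `e`, and `decr` with `>m` excludes it above
      -- `e`. If `z` is below `d`, then either `d-b` is violated by `w`, or `c`, `z`, one of `d` and
      -- `w`, `e`, `a` form a 23451.
      ... | tri> _ _ m<z with <-cmp (v z) (v d) | compare z e (<⇒≢ (<-trans (<-trans z<w w<b) b<e)) (m<n⇒0<n vd<ve)
      ...   | tri> _ _ vd<vz | inj₁ vz<ve = d-e z m<z (<-trans z<w w<b) vd<vz vz<ve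
      ...   | tri> _ _ vd<vz | inj₂ ve<vz with compare w m (>⇒≢ (<-trans m<z z<w)) 0<m
      ...     | inj₁ vw<vm = decr z w m<z w<b ve<vz vw<vm z<w vz<vw
      ...     | inj₂ vm<vw = >m w (<-trans m<z z<w) w<b vm<vw
      after z w vc<vz vz<vw c<z z<w w<b | tri> _ _ m<z | tri< vz<vd _ _ | _ with order vz<vd
      ... | inj₁ z<d = increasing (0<a ∷ <-trans a<b vb<vc ∷ vc<vz ∷ vz<vd ∷ vd<ve ∷ [-]) c<z z<d d<e e<a
      ... | inj₂ d<z with compare w e (<⇒≢ (<-trans w<b b<e)) (m<n⇒0<n vd<ve)
      ...   | inj₁ vw<ve = increasing (0<a ∷ <-trans a<b vb<vc ∷ vc<vz ∷ vz<vw ∷ vw<ve ∷ [-])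
                c<z z<w (<-trans w<b b<e) e<a
      ...   | inj₂ ve<vw = d-b w (<-trans d<z z<w) w<b ve<vw
      after z w vc<vz vz<vw c<z z<w w<b | tri> _ _ m<z | tri≈ _ eq _ | _ =
        d-b w (subst (_< w) z≡d z<w) w<b
          ([ (λ vw<ve → ⊥-elim (d-e w (<-trans m<z z<w) w<b (subst (_< v w) eq vz<vw) vw<ve)) , (λ ve<vw → ve<vw) ]′
            (compare w e (<⇒≢ (<-trans w<b b<e)) (m<n⇒0<n vd<ve)))
        where
        z≡d : z ≡ d
        z≡d = val-injective π π-unique z d (m<n⇒0<n vc<vz) eq

    -- As `b` precedes `d`, the condition on entries between `d` and `b` is vacuous. Column 0
    -- supplies `before`.
    obstructs₇ : ∀ {a b c d e m} →
      Occurrence P₇ (c ∷ m ∷ b ∷ d ∷ e ∷ a ∷ []) (v a ∷ v b ∷ v c ∷ v d ∷ v e ∷ v m ∷ []) → ⊥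
    obstructs₇ {a} {b} {c} {d} {e} {m} (occurrence (c<m ∷ m<b ∷ b<d ∷ d<e ∷ e<a ∷ [-]) vs@(_ ∷ _ ∷ _ ∷ vc<vd ∷ vd<ve ∷ ve<vm ∷ [-])
            (e04 ∷ e05 ∷ e13 ∷ e14 ∷ e15 ∷ e16 ∷ e24 ∷ e26 ∷ []) ((dec ∷ []) ∷ [])) =
      spike vs c<m (<-trans m<b b<d) m<b (<-trans b<d d<e) d<e e<a col1
        (λ t m<t t<b vm<vt → e26 t ((m<t , t<b) , vm<vt , val<1+n t (m<n⇒0<n vm<vt)))
        (λ t m<t t<b vd<vt vt<ve → e24 t ((m<t , t<b) , vd<vt , vt<ve))
        (λ t d<t t<b _ → <-asym b<d (<-trans d<t t<b))
        (λ t t′ m<t t′<b ve<vt vt′<vm t<t′ vt<vt′ → <-asym vt<vt′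
          (dec t t′ ((m<t , <-trans t<t′ t′<b) , ve<vt , <-trans vt<vt′ vt′<vm)
                    ((<-trans m<t t<t′ , t′<b) , <-trans ve<vt vt<vt′ , vt′<vm) t<t′))
        before
      where
      col1 : ∀ t → c < t → t < m → ¬ v c < v t
      col1 t c<t t<m vc<vt with compare t d (<⇒≢ (<-trans t<m (<-trans m<b b<d))) (m<n⇒0<n vc<vd)
      ... | inj₁ vt<vd = e13 t ((c<t , t<m) , vc<vt , vt<vd)
      ... | inj₂ vd<vt with compare t e (<⇒≢ (<-trans t<m (<-trans m<b (<-trans b<d d<e)))) (m<n⇒0<n vd<ve)
      ...   | inj₁ vt<ve = e14 t ((c<t , t<m) , vd<vt , vt<ve)
      ...   | inj₂ ve<vt with compare t m (<⇒≢ t<m) (m<n⇒0<n ve<vm)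
      ...     | inj₁ vt<vm = e15 t ((c<t , t<m) , ve<vt , vt<vm)
      ...     | inj₂ vm<vt = e16 t ((c<t , t<m) , vm<vt , val<1+n t (m<n⇒0<n vm<vt))
      before : ∀ z → z < c → v d < v z → v z < v m → ¬ SBefore c z
      before z z<c vd<vz vz<vm _
        with compare z e (<⇒≢ (<-trans z<c (<-trans c<m (<-trans m<b (<-trans b<d d<e))))) (m<n⇒0<n vd<ve)
      ... | inj₁ vz<ve = e04 z ((0<val⇒0< z (m<n⇒0<n vd<vz) , z<c) , vd<vz , vz<ve)
      ... | inj₂ ve<vz = e05 z ((0<val⇒0< z (m<n⇒0<n vd<vz) , z<c) , ve<vz , vz<vm)

    -- `d` splits the stretch from `m` to `b` into columns 2 and 3. Column 3 holds nothing above
    -- `d`, so the conditions given by column 2 extend from `d` to `b`.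
    obstructs₈ : ∀ {a b c d e m} →
      Occurrence P₈ (c ∷ m ∷ d ∷ b ∷ e ∷ a ∷ []) (v a ∷ v b ∷ v c ∷ v d ∷ v e ∷ v m ∷ []) → ⊥
    obstructs₈ {a} {b} {c} {d} {e} {m} (occurrence (c<m ∷ m<d ∷ d<b ∷ b<e ∷ e<a ∷ [-]) vs@(_ ∷ _ ∷ _ ∷ vc<vd ∷ vd<ve ∷ ve<vm ∷ [-])
            (e04 ∷ e05 ∷ e13 ∷ e14 ∷ e15 ∷ e16 ∷ e24 ∷ e26 ∷ e34 ∷ e35 ∷ e36 ∷ []) ((dec ∷ []) ∷ [])) =
      spike vs c<m m<d (<-trans m<d d<b) b<e (<-trans d<b b<e) e<a col1 >m d-e
        (λ t d<t t<b ve<vt → col3 t d<t t<b (<-trans vd<ve ve<vt)) decr′ before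
      where
      col1 : ∀ t → c < t → t < m → ¬ v c < v t
      col1 t c<t t<m vc<vt with compare t d (<⇒≢ (<-trans t<m m<d)) (m<n⇒0<n vc<vd)
      ... | inj₁ vt<vd = e13 t ((c<t , t<m) , vc<vt , vt<vd)
      ... | inj₂ vd<vt with compare t e (<⇒≢ (<-trans t<m (<-trans m<d (<-trans d<b b<e)))) (m<n⇒0<n vd<ve)
      ...   | inj₁ vt<ve = e14 t ((c<t , t<m) , vd<vt , vt<ve)
      ...   | inj₂ ve<vt with compare t m (<⇒≢ t<m) (m<n⇒0<n ve<vm)
      ...     | inj₁ vt<vm = e15 t ((c<t , t<m) , ve<vt , vt<vm)
      ...     | inj₂ vm<vt = e16 t ((c<t , t<m) , vm<vt , val<1+n t (m<n⇒0<n vm<vt))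
      col3 : ∀ t → d < t → t < b → ¬ v d < v t
      col3 t d<t t<b vd<vt with compare t e (<⇒≢ (<-trans t<b b<e)) (m<n⇒0<n vd<ve)
      ... | inj₁ vt<ve = e34 t ((d<t , t<b) , vd<vt , vt<ve)
      ... | inj₂ ve<vt with compare t m (>⇒≢ (<-trans m<d d<t)) (m<n⇒0<n ve<vm)
      ...   | inj₁ vt<vm = e35 t ((d<t , t<b) , ve<vt , vt<vm)
      ...   | inj₂ vm<vt = e36 t ((d<t , t<b) , vm<vt , val<1+n t (m<n⇒0<n vm<vt))
      >m : ∀ t → m < t → t < b → ¬ v m < v t
      >m t m<t t<b vm<vt with order (<-trans (<-trans vd<ve ve<vm) vm<vt)
      ... | inj₁ d<t = col3 t d<t t<b (<-trans (<-trans vd<ve ve<vm) vm<vt)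
      ... | inj₂ t<d = e26 t ((m<t , t<d) , vm<vt , val<1+n t (m<n⇒0<n vm<vt))
      d-e : ∀ t → m < t → t < b → v d < v t → ¬ v t < v e
      d-e t m<t t<b vd<vt vt<ve with order vd<vt
      ... | inj₁ d<t = col3 t d<t t<b vd<vt
      ... | inj₂ t<d = e24 t ((m<t , t<d) , vd<vt , vt<ve)
      decr′ : ∀ t t′ → m < t → t′ < b → v e < v t → v t′ < v m → t < t′ → ¬ v t < v t′
      decr′ t t′ m<t t′<b ve<vt vt′<vm t<t′ vt<vt′ with order (<-trans (<-trans vd<ve ve<vt) vt<vt′)
      ... | inj₁ d<t′ = col3 t′ d<t′ t′<b (<-trans (<-trans vd<ve ve<vt) vt<vt′)
      ... | inj₂ t′<d = <-asym vt<vt′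
              (dec t t′ ((m<t , <-trans t<t′ t′<d) , ve<vt , <-trans vt<vt′ vt′<vm)
                        ((<-trans m<t t<t′ , t′<d) , <-trans ve<vt vt<vt′ , vt′<vm) t<t′)
      before : ∀ z → z < c → v d < v z → v z < v m → ¬ SBefore c z
      before z z<c vd<vz vz<vm _
        with compare z e (<⇒≢ (<-trans z<c (<-trans c<m (<-trans m<d (<-trans d<b b<e))))) (m<n⇒0<n vd<ve)
      ... | inj₁ vz<ve = e04 z ((0<val⇒0< z (m<n⇒0<n vd<vz) , z<c) , vd<vz , vz<ve)
      ... | inj₂ ve<vz = e05 z ((0<val⇒0< z (m<n⇒0<n vd<vz) , z<c) , ve<vz , vz<vm)

    obstructs₉ : ∀ {N a b c d e m} →
      Occurrence P₉ (N ∷ c ∷ m ∷ b ∷ d ∷ e ∷ a ∷ []) (v a ∷ v b ∷ v c ∷ v d ∷ v e ∷ v m ∷ v N ∷ []) → ⊥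
    obstructs₉ {N} {a} {b} {c} {d} {e} {m} (occurrence (N<c ∷ c<m ∷ m<b ∷ b<d ∷ d<e ∷ e<a ∷ [-])
            (0<a ∷ a<b ∷ vb<vc ∷ vc<vd ∷ vd<ve ∷ ve<vm ∷ vm<vN ∷ [-])
            (e14 ∷ e15 ∷ _ ∷ _ ∷ e23 ∷ e24 ∷ e25 ∷ e26 ∷ e27 ∷ e34 ∷ e36 ∷ e37 ∷ [])
            ((dec ∷ []) ∷ [])) =
      spike (0<a ∷ a<b ∷ vb<vc ∷ vc<vd ∷ vd<ve ∷ ve<vm ∷ [-])
        c<m (<-trans m<b b<d) m<b (<-trans b<d d<e) d<e e<a col2 >m
        (λ t m<t t<b vd<vt vt<ve → e34 t ((m<t , t<b) , vd<vt , vt<ve))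
        (λ t d<t t<b _ → <-asym b<d (<-trans d<t t<b))
        (λ t t′ m<t t′<b ve<vt vt′<vm t<t′ vt<vt′ → <-asym vt<vt′
          (dec t t′ ((m<t , <-trans t<t′ t′<b) , ve<vt , <-trans vt<vt′ vt′<vm)
                    ((<-trans m<t t<t′ , t′<b) , <-trans ve<vt vt<vt′ , vt′<vm) t<t′))
        before
      where
      col2 : ∀ t → c < t → t < m → ¬ v c < v t
      col2 t c<t t<m vc<vt with compare t d (<⇒≢ (<-trans t<m (<-trans m<b b<d))) (m<n⇒0<n vc<vd)
      ... | inj₁ vt<vd = e23 t ((c<t , t<m) , vc<vt , vt<vd)
      ... | inj₂ vd<vt with compare t e (<⇒≢ (<-trans t<m (<-trans m<b (<-trans b<d d<e)))) (m<n⇒0<n vd<ve)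
      ...   | inj₁ vt<ve = e24 t ((c<t , t<m) , vd<vt , vt<ve)
      ...   | inj₂ ve<vt with compare t m (<⇒≢ t<m) (m<n⇒0<n ve<vm)
      ...     | inj₁ vt<vm = e25 t ((c<t , t<m) , ve<vt , vt<vm)
      ...     | inj₂ vm<vt with compare t N (>⇒≢ (<-trans N<c c<t)) (m<n⇒0<n vm<vN)
      ...       | inj₁ vt<vN = e26 t ((c<t , t<m) , vm<vt , vt<vN)
      ...       | inj₂ vN<vt = e27 t ((c<t , t<m) , vN<vt , val<1+n t (m<n⇒0<n vm<vt))
      >m : ∀ t → m < t → t < b → ¬ v m < v t
      >m t m<t t<b vm<vt with compare t N (>⇒≢ (<-trans (<-trans N<c c<m) m<t)) (m<n⇒0<n vm<vN)
      ... | inj₁ vt<vN = e36 t ((m<t , t<b) , vm<vt , vt<vN)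
      ... | inj₂ vN<vt = e37 t ((m<t , t<b) , vN<vt , val<1+n t (m<n⇒0<n vm<vt))
      before : ∀ z → z < c → v d < v z → v z < v m → ¬ SBefore c z
      before z z<c vd<vz vz<vm c-z with order (<-trans vz<vm vm<vN)
      -- `N` stands between `z` and `c` and exceeds `z`, so `c` does not precede `z` in S π. This
      -- replaces the shading to the left of `N`.
      ... | inj₁ z<N = c-z N z<N N<c (<-trans vz<vm vm<vN)
      ... | inj₂ N<z
        with compare z e (<⇒≢ (<-trans z<c (<-trans c<m (<-trans m<b (<-trans b<d d<e))))) (m<n⇒0<n vd<ve)
      ...   | inj₁ vz<ve = e14 z ((N<z , z<c) , vd<vz , vz<ve)
      ...   | inj₂ ve<vz = e15 z ((N<z , z<c) , ve<vz , vz<vm)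

    -- Combines the split at `d` from `obstructs₈` with the role of `N` in `obstructs₉`.
    obstructs₁₀ : ∀ {N a b c d e m} →
      Occurrence P₁₀ (N ∷ c ∷ m ∷ d ∷ b ∷ e ∷ a ∷ []) (v a ∷ v b ∷ v c ∷ v d ∷ v e ∷ v m ∷ v N ∷ []) → ⊥
    obstructs₁₀ {N} {a} {b} {c} {d} {e} {m} (occurrence (N<c ∷ c<m ∷ m<d ∷ d<b ∷ b<e ∷ e<a ∷ [-])
            (0<a ∷ a<b ∷ vb<vc ∷ vc<vd ∷ vd<ve ∷ ve<vm ∷ vm<vN ∷ [-])
            (e14 ∷ e15 ∷ _ ∷ _ ∷ e23 ∷ e24 ∷ e25 ∷ e26 ∷ e27 ∷ e34 ∷ e36 ∷ e37 ∷
             e44 ∷ e45 ∷ e46 ∷ e47 ∷ [])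
            ((dec ∷ []) ∷ [])) =
      spike (0<a ∷ a<b ∷ vb<vc ∷ vc<vd ∷ vd<ve ∷ ve<vm ∷ [-])
        c<m m<d (<-trans m<d d<b) b<e (<-trans d<b b<e) e<a col2 >m d-e
        (λ t d<t t<b ve<vt → col4 t d<t t<b (<-trans vd<ve ve<vt)) decr′ before
      where
      col2 : ∀ t → c < t → t < m → ¬ v c < v t
      col2 t c<t t<m vc<vt with compare t d (<⇒≢ (<-trans t<m m<d)) (m<n⇒0<n vc<vd)
      ... | inj₁ vt<vd = e23 t ((c<t , t<m) , vc<vt , vt<vd)
      ... | inj₂ vd<vt with compare t e (<⇒≢ (<-trans t<m (<-trans m<d (<-trans d<b b<e)))) (m<n⇒0<n vd<ve)
      ...   | inj₁ vt<ve = e24 t ((c<t , t<m) , vd<vt , vt<ve)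
      ...   | inj₂ ve<vt with compare t m (<⇒≢ t<m) (m<n⇒0<n ve<vm)
      ...     | inj₁ vt<vm = e25 t ((c<t , t<m) , ve<vt , vt<vm)
      ...     | inj₂ vm<vt with compare t N (>⇒≢ (<-trans N<c c<t)) (m<n⇒0<n vm<vN)
      ...       | inj₁ vt<vN = e26 t ((c<t , t<m) , vm<vt , vt<vN)
      ...       | inj₂ vN<vt = e27 t ((c<t , t<m) , vN<vt , val<1+n t (m<n⇒0<n vm<vt))
      col4 : ∀ t → d < t → t < b → ¬ v d < v t
      col4 t d<t t<b vd<vt with compare t e (<⇒≢ (<-trans t<b b<e)) (m<n⇒0<n vd<ve)
      ... | inj₁ vt<ve = e44 t ((d<t , t<b) , vd<vt , vt<ve)
      ... | inj₂ ve<vt with compare t m (>⇒≢ (<-trans m<d d<t)) (m<n⇒0<n ve<vm)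
      ...   | inj₁ vt<vm = e45 t ((d<t , t<b) , ve<vt , vt<vm)
      ...   | inj₂ vm<vt with compare t N (>⇒≢ (<-trans N<c (<-trans c<m (<-trans m<d d<t)))) (m<n⇒0<n vm<vN)
      ...     | inj₁ vt<vN = e46 t ((d<t , t<b) , vm<vt , vt<vN)
      ...     | inj₂ vN<vt = e47 t ((d<t , t<b) , vN<vt , val<1+n t (m<n⇒0<n vm<vt))
      >m : ∀ t → m < t → t < b → ¬ v m < v t
      >m t m<t t<b vm<vt with order (<-trans (<-trans vd<ve ve<vm) vm<vt)
      ... | inj₁ d<t = col4 t d<t t<b (<-trans (<-trans vd<ve ve<vm) vm<vt)
      ... | inj₂ t<d with compare t N (>⇒≢ (<-trans (<-trans N<c c<m) m<t)) (m<n⇒0<n vm<vN)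
      ...   | inj₁ vt<vN = e36 t ((m<t , t<d) , vm<vt , vt<vN)
      ...   | inj₂ vN<vt = e37 t ((m<t , t<d) , vN<vt , val<1+n t (m<n⇒0<n vm<vt))
      d-e : ∀ t → m < t → t < b → v d < v t → ¬ v t < v e
      d-e t m<t t<b vd<vt vt<ve with order vd<vt
      ... | inj₁ d<t = col4 t d<t t<b vd<vt
      ... | inj₂ t<d = e34 t ((m<t , t<d) , vd<vt , vt<ve)
      decr′ : ∀ t t′ → m < t → t′ < b → v e < v t → v t′ < v m → t < t′ → ¬ v t < v t′
      decr′ t t′ m<t t′<b ve<vt vt′<vm t<t′ vt<vt′ with order (<-trans (<-trans vd<ve ve<vt) vt<vt′)
      ... | inj₁ d<t′ = col4 t′ d<t′ t′<b (<-trans (<-trans vd<ve ve<vt) vt<vt′)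
      ... | inj₂ t′<d = <-asym vt<vt′
              (dec t t′ ((m<t , <-trans t<t′ t′<d) , ve<vt , <-trans vt<vt′ vt′<vm)
                        ((<-trans m<t t<t′ , t′<d) , <-trans ve<vt vt<vt′ , vt′<vm) t<t′)
      before : ∀ z → z < c → v d < v z → v z < v m → ¬ SBefore c z
      before z z<c vd<vz vz<vm c-z with order (<-trans vz<vm vm<vN)
      ... | inj₁ z<N = c-z N z<N N<c (<-trans vz<vm vm<vN)
      ... | inj₂ N<z
        with compare z e (<⇒≢ (<-trans z<c (<-trans c<m (<-trans m<d (<-trans d<b b<e))))) (m<n⇒0<n vd<ve)
      ...   | inj₁ vz<ve = e14 z ((N<z , z<c) , vd<vz , vz<ve)
      ...   | inj₂ ve<vz = e15 z ((N<z , z<c) , ve<vz , vz<vm)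

    -- From explicit occurrences to avoidance

    avoids₁ : Avoids P₁ π
    avoids₁ (is@(b ∷ c ∷ d ∷ e ∷ a ∷ []) , o@(cl@(refl , _) , _)) =
      obstructs₁ (occurrence⁻ P₁ is _ refl refl refl
        (increasing-values π-positive P₁ is 4 (0 ∷ 1 ∷ 2 ∷ 3 ∷ []) cl) o)

    avoids₂ : Avoids P₂ π
    avoids₂ (is@(b ∷ d ∷ c ∷ e ∷ a ∷ []) , o@(cl@(refl , _) , _)) =
      obstructs₂ (occurrence⁻ P₂ is _ refl refl refl
        (increasing-values π-positive P₂ is 4 (0 ∷ 2 ∷ 1 ∷ 3 ∷ []) cl) o)

    avoids₃ : Avoids P₃ π
    avoids₃ (is@(c ∷ b ∷ d ∷ e ∷ a ∷ []) , o@(cl@(refl , _) , _)) =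
      obstructs₃ (occurrence⁻ P₃ is _ refl refl refl
        (increasing-values π-positive P₃ is 4 (1 ∷ 0 ∷ 2 ∷ 3 ∷ []) cl) o)

    avoids₄ : Avoids P₄ π
    avoids₄ (is@(d ∷ b ∷ c ∷ e ∷ a ∷ []) , o@(cl@(refl , _) , _)) =
      obstructs₄ (occurrence⁻ P₄ is _ refl refl refl
        (increasing-values π-positive P₄ is 4 (1 ∷ 2 ∷ 0 ∷ 3 ∷ []) cl) o)

    avoids₅ : Avoids P₅ π
    avoids₅ (is@(d ∷ c ∷ b ∷ e ∷ a ∷ []) , o@(cl@(refl , _) , _)) =
      obstructs₅ (occurrence⁻ P₅ is _ refl refl refl
        (increasing-values π-positive P₅ is 4 (2 ∷ 1 ∷ 0 ∷ 3 ∷ []) cl) o)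

    avoids₆ : Avoids P₆ π
    avoids₆ (is@(c ∷ d ∷ b ∷ e ∷ a ∷ []) , o@(cl@(refl , _) , _)) =
      obstructs₆ (occurrence⁻ P₆ is _ refl refl refl
        (increasing-values π-positive P₆ is 4 (2 ∷ 0 ∷ 1 ∷ 3 ∷ []) cl) o)

    avoids₇ : Avoids P₇ π
    avoids₇ (is@(c ∷ m ∷ b ∷ d ∷ e ∷ a ∷ []) , o@(cl@(refl , _) , _)) =
      obstructs₇ (occurrence⁻ P₇ is _ refl refl refl
        (increasing-values π-positive P₇ is 5 (2 ∷ 0 ∷ 3 ∷ 4 ∷ 1 ∷ []) cl) o)

    avoids₈ : Avoids P₈ π
    avoids₈ (is@(c ∷ m ∷ d ∷ b ∷ e ∷ a ∷ []) , o@(cl@(refl , _) , _)) =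
      obstructs₈ (occurrence⁻ P₈ is _ refl refl refl
        (increasing-values π-positive P₈ is 5 (3 ∷ 0 ∷ 2 ∷ 4 ∷ 1 ∷ []) cl) o)

    avoids₉ : Avoids P₉ π
    avoids₉ (is@(N ∷ c ∷ m ∷ b ∷ d ∷ e ∷ a ∷ []) , o@(cl@(refl , _) , _)) =
      obstructs₉ (occurrence⁻ P₉ is _ refl refl refl
        (increasing-values π-positive P₉ is 6 (3 ∷ 1 ∷ 4 ∷ 5 ∷ 2 ∷ 0 ∷ []) cl) o)

    avoids₁₀ : Avoids P₁₀ π
    avoids₁₀ (is@(N ∷ c ∷ m ∷ d ∷ b ∷ e ∷ a ∷ []) , o@(cl@(refl , _) , _)) =
      obstructs₁₀ (occurrence⁻ P₁₀ is _ refl refl refl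
        (increasing-values π-positive P₁₀ is 6 (4 ∷ 1 ∷ 3 ∷ 5 ∷ 2 ∷ 0 ∷ []) cl) o)

    avoids-all : All (λ P → Avoids P π) westPatterns
    avoids-all = avoids₁ ∷ avoids₂ ∷ avoids₃ ∷ avoids₄ ∷ avoids₅ ∷ avoids₆ ∷
                 avoids₇ ∷ avoids₈ ∷ avoids₉ ∷ avoids₁₀ ∷ []

  -- Every obstruction contains a pattern

  module _ (o : Obstruction) where

    open Obstruction o

    private
      vb<vc : v b < v c
      vb<vc with _ ∷ _ ∷ p ∷ _ ← values = p
      vc<vd : v c < v d
      vc<vd with _ ∷ _ ∷ _ ∷ p ∷ _ ← values = p
      vd<ve : v d < v e
      vd<ve with _ ∷ _ ∷ _ ∷ _ ∷ p ∷ _ ← values = p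
      vb<vd : v b < v d
      vb<vd = <-trans vb<vc vc<vd

      Contains : Set
      Contains = Any (λ P → Occurs P π) westPatterns

      vals₅ : List ℕ
      vals₅ = v a ∷ v b ∷ v c ∷ v d ∷ v e ∷ []

    -- Otherwise `e`, which exceeds `d`, would lie between `d` and `c`, against `c-d`.
    c<e : c < e
    c<e with order (<-trans vc<vd vd<ve)
    ... | inj₁ c<e = c<e
    ... | inj₂ e<c = ⊥-elim (c-d e d<e e<c vd<ve)

    -- Otherwise `d` and `e` would be the witnesses `z` and `w` that `b-c` forbids.
    b<e : b < e
    b<e with order (<-trans vb<vd vd<ve)
    ... | inj₁ b<e = b<e
    ... | inj₂ e<b = ⊥-elim (b-c d e vc<vd c-d d<e e<b vd<ve)

    -- The place of `d` relative to `b` and `c` selects pattern 1, 2 or 4, and `c-d` empties the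
    -- shaded boxes.
    b-before-c : b < c → Contains
    b-before-c b<c with order vc<vd | order vb<vd
    ... | inj₁ c<d | _ = here (occurs P₁ (b ∷ c ∷ d ∷ e ∷ a ∷ []) vals₅ refl refl refl refl
            (occurrence (b<c ∷ c<d ∷ d<e ∷ e<a ∷ [-]) values [] []))
    ... | inj₂ d<c | inj₁ b<d = there (here (occurs P₂ (b ∷ d ∷ c ∷ e ∷ a ∷ []) vals₅ refl refl refl refl
            (occurrence (b<d ∷ d<c ∷ c<e ∷ e<a ∷ [-]) values
              ((λ { t ((d<t , t<c) , lo , _) → c-d t d<t t<c lo }) ∷
               (λ { t ((d<t , t<c) , lo , _) → c-d t d<t t<c (<-trans vd<ve lo) }) ∷ []) [])))
    ... | inj₂ d<c | inj₂ d<b = there (there (there (here (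
            occurs P₄ (d ∷ b ∷ c ∷ e ∷ a ∷ []) vals₅ refl refl refl refl
            (occurrence (d<b ∷ b<c ∷ c<e ∷ e<a ∷ [-]) values
              ((λ { t ((d<t , t<b) , lo , _) → c-d t d<t (<-trans t<b b<c) lo }) ∷
               (λ { t ((d<t , t<b) , lo , _) → c-d t d<t (<-trans t<b b<c) (<-trans vd<ve lo) }) ∷
               (λ { t ((b<t , t<c) , lo , _) → c-d t (<-trans d<b b<t) t<c lo }) ∷
               (λ { t ((b<t , t<c) , lo , _) → c-d t (<-trans d<b b<t) t<c (<-trans vd<ve lo) }) ∷ []) [])))))

    none-between : c < b → (∀ t → c < t → t < b → ¬ v c < v t) → Contains
    none-between c<b none with order vc<vd
    ... | inj₂ d<c = there (there (there (there (here (
            occurs P₅ (d ∷ c ∷ b ∷ e ∷ a ∷ []) vals₅ refl refl refl refl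
            (occurrence (d<c ∷ c<b ∷ b<e ∷ e<a ∷ [-]) values
              ((λ { t ((d<t , t<c) , lo , _) → c-d t d<t t<c lo }) ∷
               (λ { t ((d<t , t<c) , lo , _) → c-d t d<t t<c (<-trans vd<ve lo) }) ∷
               (λ { t ((c<t , t<b) , lo , _) → none t c<t t<b lo }) ∷
               (λ { t ((c<t , t<b) , lo , _) → none t c<t t<b (<-trans vc<vd lo) }) ∷
               (λ { t ((c<t , t<b) , lo , _) → none t c<t t<b (<-trans (<-trans vc<vd vd<ve) lo) }) ∷ []) []))))))
    ... | inj₁ c<d with order vb<vd
    -- In the order `c`, `d`, `b` the entry `d` itself would exceed `c` between `c` and `b`.
    ...   | inj₂ d<b = ⊥-elim (none d c<d d<b vc<vd)
    ...   | inj₁ b<d = there (there (here (occurs P₃ (c ∷ b ∷ d ∷ e ∷ a ∷ []) vals₅ refl refl refl refl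
            (occurrence (c<b ∷ b<d ∷ d<e ∷ e<a ∷ [-]) values
              ((λ { t ((c<t , t<b) , lo , _) → none t c<t t<b lo }) ∷
               (λ { t ((c<t , t<b) , lo , _) → none t c<t t<b (<-trans vc<vd lo) }) ∷
               (λ { t ((c<t , t<b) , lo , _) → none t c<t t<b (<-trans (<-trans vc<vd vd<ve) lo) }) ∷ []) []))))

    -- The entries larger than c between c and b decrease; m is the first,
    -- hence the largest, of them.
    module _ {m : ℕ} (c<m : c < m) (m<b : m < b) (vc<vm : v c < v m)
      (first : ∀ t → c < t → t < m → ¬ v c < v t) where

      -- An entry `z` larger and later than `c` also follows it in S π, so `b-c` leaves no larger
      -- `w` between `z` and `b`.
      descending : ∀ z w → v c < v z → c < z → z < w → w < b → ¬ v z < v w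
      descending z w vc<vz c<z = b-c z w vc<vz (<⇒SBefore c<z)

      -- `m` takes the role of `d`: column 1 is empty by `first`, column 2 by `descending`.
      below-e : v m < v e → Contains
      below-e vm<ve with 0<a ∷ a<b ∷ _ ← values =
        there (there (there (there (there (here (occurs P₆ (c ∷ m ∷ b ∷ e ∷ a ∷ [])
          (v a ∷ v b ∷ v c ∷ v m ∷ v e ∷ []) refl refl refl refl
          (occurrence (c<m ∷ m<b ∷ b<e ∷ e<a ∷ [-]) (0<a ∷ a<b ∷ vb<vc ∷ vc<vm ∷ vm<ve ∷ [-])
            ((λ { t ((c<t , t<m) , lo , _) → first t c<t t<m lo }) ∷
             (λ { t ((c<t , t<m) , lo , _) → first t c<t t<m (<-trans vc<vm lo) }) ∷
             (λ { t ((c<t , t<m) , lo , _) → first t c<t t<m (<-trans (<-trans vc<vm vm<ve) lo) }) ∷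
             (λ { t ((m<t , t<b) , lo , _) → descending m t vc<vm c<m m<t t<b lo }) ∷
             (λ { t ((m<t , t<b) , lo , _) → descending m t vc<vm c<m m<t t<b (<-trans vm<ve lo) }) ∷ []) [])))))))

      -- Otherwise the last such entry before c would witness that c precedes
      -- b in S² π.
      none-before : ∀ l → (∀ f → l < f → f < c → ¬ v m < v f) →
                    ∀ t → l < t → t < c → ¬ v c < v t
      none-before l none t l<t t<c vc<vt with greatest (λ s → v c <? v s) c
      ... | inj₁ none′ = none′ t t<c vc<vt
      ... | inj₂ (g , g<c , vc<vg , last)
        with compare g m (<⇒≢ (<-trans g<c c<m)) (m<n⇒0<n vc<vm)
      ...   | inj₁ vg<vm = b-c g m vc<vg
                (λ f g<f f<c vg<vf → last f g<f f<c (<-trans vc<vg vg<vf))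
                (<-trans g<c c<m) m<b vg<vm
      -- Since `g` is the last entry before `c` above `c`, it is not before `t`, hence it lies after
      -- `l`.
      ...   | inj₂ vm<vg = none g (<-≤-trans l<t (≮⇒≥ λ g<t → last t g<t t<c vc<vt)) g<c vm<vg

      decreasing-between : ∀ t t′ → m < t → t′ < b → v e < v t → t < t′ → v t′ < v t
      decreasing-between t t′ m<t t′<b ve<vt t<t′
        with compare t′ t (>⇒≢ t<t′) (m<n⇒0<n ve<vt)
      ... | inj₁ lt = lt
      ... | inj₂ gt = ⊥-elim
              (descending t t′ (<-trans (<-trans vc<vd vd<ve) ve<vt) (<-trans c<m m<t) t<t′ t′<b gt)

      -- The first search looks for a replacement `d′` of `d` between `c` and `b` (found: patterns 8
      -- and 10; otherwise 7 and 9). The second looks for the last entry `N` before `c` above `m`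
      -- (found: 9 and 10; otherwise 7 and 8).
      above-e : v e < v m → Contains
      above-e ve<vm with 0<a ∷ a<b ∷ _ ← values
        with least (λ t → (c <? t) ×-dec ((v c <? v t) ×-dec (v t <? v e))) b
           | greatest (λ t → v m <? v t) c
      ... | inj₂ (d′ , d′<b , (c<d′ , vc<vd′ , vd′<ve) , first′) | last? = found last?
        where
        m<d′ : m < d′
        m<d′ with order (<-trans vd′<ve ve<vm)
        ... | inj₂ m<d′ = m<d′
        -- `m` is the first entry after `c` that exceeds `c`, and `d′` is another one.
        ... | inj₁ d′<m = ⊥-elim (first d′ c<d′ d′<m vc<vd′)
        d′-e : ∀ t → c < t → t < d′ → v d′ < v t → ¬ v t < v e
        d′-e t c<t t<d′ lo hi = first′ t t<d′ (c<t , <-trans vc<vd′ lo , hi)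
        vc<ve : v c < v e
        vc<ve = <-trans vc<vd vd<ve
        found : _ → Contains
        found (inj₁ none) =
          there (there (there (there (there (there (there (here (occurs P₈ (c ∷ m ∷ d′ ∷ b ∷ e ∷ a ∷ [])
            (v a ∷ v b ∷ v c ∷ v d′ ∷ v e ∷ v m ∷ []) refl refl refl refl
            (occurrence (c<m ∷ m<d′ ∷ d′<b ∷ b<e ∷ e<a ∷ [-])
              (0<a ∷ a<b ∷ vb<vc ∷ vc<vd′ ∷ vd′<ve ∷ ve<vm ∷ [-])
              ((λ { t ((0<t , t<c) , lo , _) → none₀ t 0<t t<c (<-trans vc<vd′ lo) }) ∷
               (λ { t ((0<t , t<c) , lo , _) → none₀ t 0<t t<c (<-trans vc<ve lo) }) ∷
               (λ { t ((c<t , t<m) , lo , _) → first t c<t t<m lo }) ∷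
               (λ { t ((c<t , t<m) , lo , _) → first t c<t t<m (<-trans vc<vd′ lo) }) ∷
               (λ { t ((c<t , t<m) , lo , _) → first t c<t t<m (<-trans vc<ve lo) }) ∷
               (λ { t ((c<t , t<m) , lo , _) → first t c<t t<m (<-trans vc<vm lo) }) ∷
               (λ { t ((m<t , t<d′) , lo , hi) → d′-e t (<-trans c<m m<t) t<d′ lo hi }) ∷
               (λ { t ((m<t , t<d′) , lo , _) → descending m t vc<vm c<m m<t (<-trans t<d′ d′<b) lo }) ∷
               (λ { t ((d′<t , t<b) , lo , _) → descending d′ t vc<vd′ c<d′ d′<t t<b lo }) ∷
               (λ { t ((d′<t , t<b) , lo , _) → descending d′ t vc<vd′ c<d′ d′<t t<b (<-trans vd′<ve lo) }) ∷
               (λ { t ((d′<t , t<b) , lo , _) → descending d′ t vc<vd′ c<d′ d′<t t<b (<-trans (<-trans vd′<ve ve<vm) lo) }) ∷ [])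
              (((λ { t t′ ((m<t , _) , lo , _) ((_ , t′<d′) , _) → decreasing-between t t′ m<t (<-trans t′<d′ d′<b) lo }) ∷ []) ∷ []))))))))))
          where
          none₀ : ∀ t → 0 < t → t < c → ¬ v c < v t
          -- Positions start at 1, so the bound 0 covers everything in front of `c`.
          none₀ = none-before 0 λ f _ → none f
        found (inj₂ (N , N<c , vm<vN , last)) =
          there (there (there (there (there (there (there (there (there (here (
            occurs P₁₀ (N ∷ c ∷ m ∷ d′ ∷ b ∷ e ∷ a ∷ [])
            (v a ∷ v b ∷ v c ∷ v d′ ∷ v e ∷ v m ∷ v N ∷ []) refl refl refl refl
            (occurrence (N<c ∷ c<m ∷ m<d′ ∷ d′<b ∷ b<e ∷ e<a ∷ [-])
              (0<a ∷ a<b ∷ vb<vc ∷ vc<vd′ ∷ vd′<ve ∷ ve<vm ∷ vm<vN ∷ [-])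
              ((λ { t ((N<t , t<c) , lo , _) → none₁ t N<t t<c (<-trans vc<vd′ lo) }) ∷
               (λ { t ((N<t , t<c) , lo , _) → none₁ t N<t t<c (<-trans vc<ve lo) }) ∷
               (λ { t ((N<t , t<c) , lo , _) → last t N<t t<c lo }) ∷
               (λ { t ((N<t , t<c) , lo , _) → last t N<t t<c (<-trans vm<vN lo) }) ∷
               (λ { t ((c<t , t<m) , lo , _) → first t c<t t<m lo }) ∷
               (λ { t ((c<t , t<m) , lo , _) → first t c<t t<m (<-trans vc<vd′ lo) }) ∷
               (λ { t ((c<t , t<m) , lo , _) → first t c<t t<m (<-trans vc<ve lo) }) ∷
               (λ { t ((c<t , t<m) , lo , _) → first t c<t t<m (<-trans vc<vm lo) }) ∷
               (λ { t ((c<t , t<m) , lo , _) → first t c<t t<m (<-trans (<-trans vc<vm vm<vN) lo) }) ∷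
               (λ { t ((m<t , t<d′) , lo , hi) → d′-e t (<-trans c<m m<t) t<d′ lo hi }) ∷
               (λ { t ((m<t , t<d′) , lo , _) → descending m t vc<vm c<m m<t (<-trans t<d′ d′<b) lo }) ∷
               (λ { t ((m<t , t<d′) , lo , _) → descending m t vc<vm c<m m<t (<-trans t<d′ d′<b) (<-trans vm<vN lo) }) ∷
               (λ { t ((d′<t , t<b) , lo , _) → descending d′ t vc<vd′ c<d′ d′<t t<b lo }) ∷
               (λ { t ((d′<t , t<b) , lo , _) → descending d′ t vc<vd′ c<d′ d′<t t<b (<-trans vd′<ve lo) }) ∷
               (λ { t ((d′<t , t<b) , lo , _) → descending d′ t vc<vd′ c<d′ d′<t t<b (<-trans (<-trans vd′<ve ve<vm) lo) }) ∷
               (λ { t ((d′<t , t<b) , lo , _) → descending d′ t vc<vd′ c<d′ d′<t t<b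
                      (<-trans (<-trans vd′<ve (<-trans ve<vm vm<vN)) lo) }) ∷ [])
              (((λ { t t′ ((m<t , _) , lo , _) ((_ , t′<d′) , _) → decreasing-between t t′ m<t (<-trans t′<d′ d′<b) lo }) ∷ []) ∷ []))))))))))))
          where
          none₁ : ∀ t → N < t → t < c → ¬ v c < v t
          none₁ = none-before N last
      ... | inj₁ all>e | last? = found last?
        where
        vc<ve : v c < v e
        vc<ve = <-trans vc<vd vd<ve
        -- If d precedes c, then c, d, m, b show that c precedes b in S² π.
        b<d : b < d
        b<d with order vc<vd | order vb<vd
        ... | inj₂ d<c | _        = ⊥-elim (b-c d m vc<vd c-d (<-trans d<c c<m) m<b (<-trans vd<ve ve<vm))
        ... | inj₁ c<d | inj₂ d<b = ⊥-elim (all>e d d<b (c<d , vc<vd , vd<ve))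
        ... | inj₁ c<d | inj₁ b<d = b<d
        d-e : ∀ t → m < t → t < b → v d < v t → ¬ v t < v e
        d-e t m<t t<b lo hi = all>e t t<b (<-trans c<m m<t , <-trans vc<vd lo , hi)
        found : _ → Contains
        found (inj₁ none) =
          there (there (there (there (there (there (here (occurs P₇ (c ∷ m ∷ b ∷ d ∷ e ∷ a ∷ [])
            (v a ∷ v b ∷ v c ∷ v d ∷ v e ∷ v m ∷ []) refl refl refl refl
            (occurrence (c<m ∷ m<b ∷ b<d ∷ d<e ∷ e<a ∷ [-])
              (0<a ∷ a<b ∷ vb<vc ∷ vc<vd ∷ vd<ve ∷ ve<vm ∷ [-])
              ((λ { t ((0<t , t<c) , lo , _) → none₀ t 0<t t<c (<-trans vc<vd lo) }) ∷
               (λ { t ((0<t , t<c) , lo , _) → none₀ t 0<t t<c (<-trans vc<ve lo) }) ∷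
               (λ { t ((c<t , t<m) , lo , _) → first t c<t t<m lo }) ∷
               (λ { t ((c<t , t<m) , lo , _) → first t c<t t<m (<-trans vc<vd lo) }) ∷
               (λ { t ((c<t , t<m) , lo , _) → first t c<t t<m (<-trans vc<ve lo) }) ∷
               (λ { t ((c<t , t<m) , lo , _) → first t c<t t<m (<-trans vc<vm lo) }) ∷
               (λ { t ((m<t , t<b) , lo , hi) → d-e t m<t t<b lo hi }) ∷
               (λ { t ((m<t , t<b) , lo , _) → descending m t vc<vm c<m m<t t<b lo }) ∷ [])
              (((λ { t t′ ((m<t , _) , lo , _) ((_ , t′<b) , _) → decreasing-between t t′ m<t t′<b lo }) ∷ []) ∷ [])))))))))
          where
          none₀ : ∀ t → 0 < t → t < c → ¬ v c < v t
          none₀ = none-before 0 λ f _ → none f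
        found (inj₂ (N , N<c , vm<vN , last)) =
          there (there (there (there (there (there (there (there (here (
            occurs P₉ (N ∷ c ∷ m ∷ b ∷ d ∷ e ∷ a ∷ [])
            (v a ∷ v b ∷ v c ∷ v d ∷ v e ∷ v m ∷ v N ∷ []) refl refl refl refl
            (occurrence (N<c ∷ c<m ∷ m<b ∷ b<d ∷ d<e ∷ e<a ∷ [-])
              (0<a ∷ a<b ∷ vb<vc ∷ vc<vd ∷ vd<ve ∷ ve<vm ∷ vm<vN ∷ [-])
              ((λ { t ((N<t , t<c) , lo , _) → none₁ t N<t t<c (<-trans vc<vd lo) }) ∷
               (λ { t ((N<t , t<c) , lo , _) → none₁ t N<t t<c (<-trans vc<ve lo) }) ∷
               (λ { t ((N<t , t<c) , lo , _) → last t N<t t<c lo }) ∷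
               (λ { t ((N<t , t<c) , lo , _) → last t N<t t<c (<-trans vm<vN lo) }) ∷
               (λ { t ((c<t , t<m) , lo , _) → first t c<t t<m lo }) ∷
               (λ { t ((c<t , t<m) , lo , _) → first t c<t t<m (<-trans vc<vd lo) }) ∷
               (λ { t ((c<t , t<m) , lo , _) → first t c<t t<m (<-trans vc<ve lo) }) ∷
               (λ { t ((c<t , t<m) , lo , _) → first t c<t t<m (<-trans vc<vm lo) }) ∷
               (λ { t ((c<t , t<m) , lo , _) → first t c<t t<m (<-trans (<-trans vc<vm vm<vN) lo) }) ∷
               (λ { t ((m<t , t<b) , lo , hi) → d-e t m<t t<b lo hi }) ∷
               (λ { t ((m<t , t<b) , lo , _) → descending m t vc<vm c<m m<t t<b lo }) ∷
               (λ { t ((m<t , t<b) , lo , _) → descending m t vc<vm c<m m<t t<b (<-trans vm<vN lo) }) ∷ [])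
              (((λ { t t′ ((m<t , _) , lo , _) ((_ , t′<b) , _) → decreasing-between t t′ m<t t′<b lo }) ∷ []) ∷ [])))))))))))
          where
          none₁ : ∀ t → N < t → t < c → ¬ v c < v t
          -- By the choice of `N`, no entry between `N` and `c` exceeds `m`.
          none₁ = none-before N last

    contains-pattern : Contains
    contains-pattern with order vb<vc
    ... | inj₁ b<c = b-before-c b<c
    ... | inj₂ c<b with least (λ t → (c <? t) ×-dec (v c <? v t)) b
    ...   | inj₁ none = none-between c<b λ t c<t t<b vc<vt → none t t<b (c<t , vc<vt)
    ...   | inj₂ (m , m<b , (c<m , vc<vm) , first)
      with compare m e (<⇒≢ (<-trans m<b b<e)) (m<n⇒0<n vd<ve)
    ...     | inj₁ vm<ve = below-e c<m m<b vc<vm (λ t c<t t<m vc<vt → first t t<m (c<t , vc<vt)) vm<ve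
    ...     | inj₂ ve<vm = above-e c<m m<b vc<vm (λ t c<t t<m vc<vt → first t t<m (c<t , vc<vt)) ve<vm

  -- Obstructions are the inversions of S (S (S π))

  private
    ordered : ∀ {i j} → 0 < v i → 0 < v j → Before (v i) (v j) π → i < j
    ordered {i} {j} 0<i 0<j b with <-cmp i j
    ... | tri< i<j _ _  = i<j
    ... | tri≈ _ refl _ = ⊥-elim (Before-asym π-unique b b)
    ... | tri> _ _ j<i  = ⊥-elim (Before-asym π-unique b (val-Before π j i 0<j 0<i j<i))

    position : x ∈ π → ∃ λ i → v i ≡ x
    position p with i , eq ← ∈-val p = suc i , eq

    S-unique : Unique (S π)
    S-unique = S-Unique π-unique

  inverted⇒Before : ∀ {i j f} → 0 < v i → v i < v j → v j < v f → j < f → f < i →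
                    Before (v j) (v i) (S π)
  inverted⇒Before {i} {j} {f} 0<i vi<vj vj<vf j<f f<i = S-inversion⁺ π-unique vi<vj vj<vf
    (val-Before π j f (m<n⇒0<n vi<vj) (m<n⇒0<n vj<vf) j<f)
    (val-Before π f i (m<n⇒0<n vj<vf) 0<i f<i)

  Before⇒inverted : ∀ {i j} → 0 < v i → v i < v j → Before (v j) (v i) (S π) →
                    ∃ λ f → v j < v f × j < f × f < i
  Before⇒inverted 0<i vi<vj p with S-inversion⁻ vi<vj p
  ... | z , vj<z , q , r with position (Before-∈ʳ q)
  ...   | f , refl = f , vj<z , ordered (m<n⇒0<n vi<vj) (m<n⇒0<n vj<z) q , ordered (m<n⇒0<n vj<z) 0<i r

  -- One of the two comes first in S π. If it were `d`, a larger entry between them in π would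
  -- contradict `c-d`.
  SBefore⇒Before : ∀ {c d} → 0 < v c → v c < v d → SBefore c d → Before (v c) (v d) (S π)
  SBefore⇒Before {c} {d} 0<c vc<vd c-d
    with Before-total (<⇒≢ vc<vd) (∈-S (val-∈ π c 0<c)) (∈-S (val-∈ π d (m<n⇒0<n vc<vd)))
  ... | inj₁ p = p
  ... | inj₂ p with f , vd<vf , d<f , f<c ← Before⇒inverted 0<c vc<vd p = ⊥-elim (c-d f d<f f<c vd<vf)

  Before⇒SBefore : ∀ {c d} → 0 < v c → v c < v d → Before (v c) (v d) (S π) → SBefore c d
  Before⇒SBefore 0<c vc<vd p f d<f f<c vd<vf =
    Before-asym S-unique p (inverted⇒Before 0<c vc<vd vd<vf d<f f<c)

  -- If `c` came first, some larger `z` would lie between `c` and `b` in S π. That `c` precedes `z`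
  -- is `SBefore c z`; that `z` precedes the smaller `b` is an inversion, with a witness `w` in π.
  S²Before⇒Before : ∀ {b c} → 0 < v b → v b < v c → S²Before b c → Before (v b) (v c) (S (S π))
  S²Before⇒Before {b} {c} 0<b vb<vc b-c
    with Before-total (<⇒≢ vb<vc) (∈-S (∈-S (val-∈ π b 0<b))) (∈-S (∈-S (val-∈ π c (m<n⇒0<n vb<vc))))
  ... | inj₁ p = p
  ... | inj₂ p with S-inversion⁻ vb<vc p
  ...   | z , vc<z , q , r with position (∈-resp-↭ (S-↭ π) (Before-∈ʳ q))
  ...     | z , refl with w , vz<vw , z<w , w<b ← Before⇒inverted 0<b (<-trans vb<vc vc<z) r =
    ⊥-elim (b-c z w vc<z (Before⇒SBefore (m<n⇒0<n vb<vc) vc<z q) z<w w<b vz<vw)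

  Before⇒S²Before : ∀ {b c} → 0 < v b → v b < v c → Before (v b) (v c) (S (S π)) → S²Before b c
  Before⇒S²Before 0<b vb<vc p z w vc<vz c-z z<w w<b vz<vw =
    Before-asym (S-Unique S-unique) p
      (S-inversion⁺ S-unique vb<vc vc<vz (SBefore⇒Before (m<n⇒0<n vb<vc) vc<vz c-z)
        (inverted⇒Before 0<b (<-trans vb<vc vc<vz) vz<vw z<w w<b))

  obstruction⇒inversion : Obstruction → ∃₂ λ x y → x < y × Before y x (S (S (S π)))
  obstruction⇒inversion (obstruction {a} {b} {c} {d} {e}
      (0<a ∷ va<vb ∷ vb<vc ∷ vc<vd ∷ vd<ve ∷ [-]) d<e e<a c-d b-c) =
    v a , v b , va<vb , S-inversion⁺ (S-Unique S-unique) va<vb vb<vc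
      (S²Before⇒Before (m<n⇒0<n va<vb) vb<vc b-c)
      (S-inversion⁺ S-unique (<-trans va<vb vb<vc) vc<vd
        (SBefore⇒Before (m<n⇒0<n vb<vc) vc<vd c-d)
        (inverted⇒Before 0<a (<-trans va<vb (<-trans vb<vc vc<vd)) vd<ve d<e e<a))

  -- Undoing `S` three times yields the middle entries `c`, `d`, `e` in turn. The precedences of `b`
  -- and `c` in S² π and of `c` and `d` in S π are then translated into conditions on π.
  inversion⇒obstruction : x < y → Before y x (S (S (S π))) → Obstruction
  inversion⇒obstruction x<y p with S-inversion⁻ x<y p
  ... | z , y<z , yz , zx
    with position (in-π (Before-∈ʳ zx)) | position (in-π (Before-∈ˡ yz)) | position (in-π (Before-∈ˡ zx))
    where
    in-π : ∀ {w} → w ∈ S (S π) → w ∈ π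
    in-π = ∈-resp-↭ (↭-trans (S-↭ (S π)) (S-↭ π))
  ...   | a , refl | b , refl | c , refl with S-inversion⁻ (<-trans x<y y<z) zx
  ...     | u , z<u , zu , ux with position (∈-resp-↭ (S-↭ π) (Before-∈ʳ zu))
  ...       | d , refl with 0<a ← All.lookup π-positive (∈-resp-↭ (S-↭ π) (Before-∈ʳ ux))
    with Before⇒inverted {a} {d} 0<a (<-trans (<-trans x<y y<z) z<u) ux
  ...         | e , vd<ve , d<e , e<a = obstruction {a} {b} {c} {d} {e} (0<a ∷ x<y ∷ y<z ∷ z<u ∷ vd<ve ∷ [-]) d<e e<a
    (Before⇒SBefore (m<n⇒0<n y<z) z<u zu) (Before⇒S²Before (m<n⇒0<n x<y) y<z yz)

-- Sortability as the absence of inversions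

theorem3p8 : (n : ℕ) (π : List ℕ) → π ↭ idPerm n →
    (West3Sortable n π ⇔ All (λ P → Avoids P π) westPatterns)
theorem3p8 n π π↭ = mk⇔ sortable⇒avoids avoids⇒sortable
  where
  length≡ : length π ≡ n
  length≡ = trans (↭-length π↭) (trans (length-map suc (upTo n)) (length-upTo n))

  range : All (λ x → 0 < x × x ≤ length π) π
  range = All-resp-↭ (↭-sym π↭) (subst (λ k → All (λ x → 0 < x × x ≤ k) (idPerm n)) (sym length≡)
    (All.map⁺ (All.map (λ i<n → z<s , i<n) (all-upTo n))))

  open Characterisation π (Unique-resp-↭ (↭-sym π↭) (AllPairs.map <⇒≢ (idPerm-increasing n))) range

  sortable⇒avoids : West3Sortable n π → All (λ P → Avoids P π) westPatterns
  sortable⇒avoids sorted = avoids-all λ o → let x , y , x<y , p = obstruction⇒inversion o in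
    <-asym x<y (Before-AllPairs (idPerm-increasing n) (subst (Before y x) sorted p))

  avoids⇒sortable : All (λ P → Avoids P π) westPatterns → West3Sortable n π
  avoids⇒sortable avoids = no-inversion⇒sorted
    (↭-trans (S-↭ (S (S π))) (↭-trans (S-↭ (S π)) (↭-trans (S-↭ π) π↭)))
    λ x<y p → All¬⇒¬Any avoids (contains-pattern (inversion⇒obstruction x<y p))
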